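{- Let $p$ be an odd prime and $r$ a positive integer. Then $$\sum_{k=0}^{p^r-1}(-1)^k(4k-1)\frac{\left(-\frac12\right)_k^3}{(1)_k^3}\equiv-(-1)^{\frac{(p-1)r}{2}}p^r\pmod{p^{r+2}}.$$
   Context: $(a)_n=a(a+1)\cdots(a+n-1)$ for $n\ge1$ and $(a)_0=1$ is the rising factorial; $(a)_k^3$ means $((a)_k)^3$. A congruence $x\equiv y\pmod{p^m}$ between rational numbers means that the $p$-adic valuation of $x-y$ is at least $m$. -}

module Defs where

open import Data.Integer using (ℤ; +_; _⊖_; ∣_∣)
import Data.Integer as ℤ
open import Data.Nat using (ℕ; zero; suc)
import Data.Nat as ℕ
open import Data.Nat.Divisibility using (_∣_; _∤_)
open import Data.Product using (_×_; ∃-syntax)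
open import Data.Rational
  using (ℚ; 0ℚ; 1ℚ; -½; _+_; _*_; _-_; -_; _/_; _÷_; ↥_; ↧ₙ_; NonZero; Positive)
open import Data.Rational.Properties
open import Relation.Binary.PropositionalEquality using (_≡_)
open import Relation.Binary.Construct.Add.Supremum.NonStrict ℤ._≤_ using (_≤⁺_)
open import Relation.Nullary.Construct.Add.Supremum using (_⁺; ⊤⁺; [_])

open import Algebra.Definitions.RawSemiring +-*-rawSemiring public using (_^_)
open import Algebra.Properties.CommutativeMonoid.Sum +-0-commutativeMonoid public
  using (sum-syntax)

rising : ℚ → ℕ → ℚ
rising a zero    = 1ℚ
rising a (suc n) = rising a n * (a + + n / 1)

rising-pos : ∀ a .{{_ : Positive a}} n → Positive (rising a n)
rising-pos a zero    = _
rising-pos a (suc n) =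
  pos*pos⇒pos (rising a n) {{rising-pos a n}} (a + + n / 1)
    {{pos+nonNeg⇒pos a (+ n / 1) {{normalize-nonNeg n 1}}}}

^-pos : ∀ a .{{_ : Positive a}} n → Positive (a ^ n)
^-pos a zero    = _
^-pos a (suc n) = pos*pos⇒pos a (a ^ n) {{^-pos a n}}

rising-1^3-nonZero : ∀ k → NonZero (rising 1ℚ k ^ 3)
rising-1^3-nonZero k =
  pos⇒nonZero (rising 1ℚ k ^ 3) {{^-pos (rising 1ℚ k) {{rising-pos 1ℚ k}} 3}}

summand : ℕ → ℚ
summand k =
  (- 1ℚ) ^ k * ((+ 4 / 1) * (+ k / 1) - 1ℚ)
    * (rising -½ k ^ 3 ÷ rising 1ℚ k ^ 3) {{rising-1^3-nonZero k}}

-- No e satisfies this for n = 0 (or for p = 1).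
ExactPower : ℕ → ℕ → ℕ → Set
ExactPower p n e = (p ℕ.^ e ∣ n) × (p ℕ.^ suc e ∤ n)

-- The graph of the p-adic valuation ℚ → ℤ ∪ {∞}, where ⊤⁺ is ∞.
data Valuation (p : ℕ) (x : ℚ) : ℤ ⁺ → Set where
  infinite : x ≡ 0ℚ → Valuation p x ⊤⁺
  finite   : ∀ {a b} → ExactPower p ∣ ↥ x ∣ a → ExactPower p (↧ₙ x) b →
             Valuation p x [ a ⊖ b ]

infix 4 _≡_[mod_^_]

_≡_[mod_^_] : ℚ → ℚ → ℕ → ℕ → Set
x ≡ y [mod p ^ m ] = ∃[ v ] Valuation p (x - y) v × [ + m ] ≤⁺ v

{-# OPTIONS --safe #-}

-- Let a = -1/2 and replace the cube by (a)_k Π_{j<k} ((j+a)² - y) / (k! Π_{1≤j≤k} (j² - y)),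
-- so that y = 0 is the given sum (up to the factor 2 in 4k - 1 = 2(a + 2k)). For every y
-- Whipple's transformation, truncated after m + 1 terms, reads
--   Σ_{k≤m} (-1)^k (a+2k) (a)_k/k! Π_{j<k} ((j+a)² - y) / Π_{1≤j≤k} (j² - y)
--     = (-1)^m a (a+1)_m/m! Σ_{k≤m} (-m)_k (m+1+a)_k (1-a)_k / (k! Π_{1≤j≤k} (j² - y)).
-- Take m = N - 1 with N = p^r. The factor (1/2)_m/m! is divisible by p^r, the terms of the
-- right-hand sum are p-integral at y = 0, and they change only by factors ≡ 1 mod p² when y = 0
-- becomes y = N²/4, since p divides N/j for 0 < j < N. At y = N²/4 the left-hand side terminates
-- and is evaluated by the Vandermonde convolution.
module Submission where

open import Defs
open import Data.Fin using (toℕ)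
open import Data.Integer using (+_)
open import Data.Nat using (ℕ; _≤_)
open import Data.Nat.Divisibility using (_∤_)
open import Data.Nat.Primality using (Prime)
open import Data.Rational using (1ℚ; -_; _*_; _/_)
import Data.Nat as ℕ

open import Algebra.Bundles using (CommutativeRing)
open import Algebra.Properties.CommutativeMonoid.Sum using (sum-init-last; sum-cong-≗)
open import Data.Fin.Properties using (toℕ-fromℕ; toℕ-inject₁)
open import Data.Integer using (ℤ; _⊖_; ∣_∣)
import Data.Integer as ℤ
open import Data.Integer.Divisibility.Signed using (∣ᵤ⇒∣; ∣⇒∣ᵤ)
  renaming (_∣_ to _∣ℤ_; ∣m∣n⇒∣m+n to ∣m∣n⇒∣m+nℤ)
import Data.Integer.Properties as ℤ
open import Data.Integer.Tactic.RingSolver using () renaming (solve-∀ to ℤ-solve-∀)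
open import Data.Nat using (zero; suc)
open import Data.Nat.Combinatorics using (k![n∸k]!∣n!)
open import Data.Nat.Coprimality using (Coprime; coprime-divisor; recompute)
import Data.Nat.Coprimality as Coprimality
open import Data.Nat.Divisibility
  using (_∣_; divides; _∣?_; ∣-trans; ∣⇒≤; ∣1⇒≡1; 1∣_; m∣m*n; ∣m⇒∣m*n; *-monoʳ-∣; *-cancelˡ-∣;
         ∣m∣n⇒∣m+n; ∣m+n∣m⇒∣n; m*n∣⇒m∣)
open import Data.Nat.DivMod using (m*n/n≡m)
open import Data.Nat.Induction using (<-rec)
open import Data.Nat.Primality using (euclidsLemma; prime⇒nonZero; prime⇒nonTrivial; prime[2])
import Data.Nat.Properties as ℕ
open import Data.Nat.Tactic.RingSolver using () renaming (solve-∀ to ℕ-solve-∀)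
open import Data.Product using (∃; _×_; _,_)
open import Data.Rational
  using (ℚ; mkℚ; 0ℚ; ½; -½; _+_; _-_; 1/_; ↥_; ↧_; ↧ₙ_; toℚᵘ; ≢-nonZero)
open import Data.Rational.Properties
open import Data.Rational.Unnormalised using (mkℚᵘ; *≡*)
import Data.Rational.Unnormalised as ℚᵘ
import Data.Rational.Unnormalised.Properties as ℚᵘ
open import Data.Sum using (_⊎_; inj₁; inj₂; [_,_]′)
open import Function using (_∘_)
open import Level using (0ℓ)
open import Relation.Binary.Construct.Add.Supremum.NonStrict ℤ._≤_ using (_≤⁺_; [_]; _≤⊤⁺)
open import Relation.Binary.PropositionalEquality
open import Relation.Nullary using (yes; no; contradiction)
open import Relation.Nullary.Construct.Add.Supremum using (⊤⁺; [_])
open import Relation.Nullary.Decidable using (dec⇒maybe)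
open import Tactic.RingSolver using (solve-∀)
open import Tactic.RingSolver.Core.AlmostCommutativeRing
  using (AlmostCommutativeRing; fromCommutativeRing)

open import Algebra.Properties.Semiring.Exp (CommutativeRing.semiring +-*-commutativeRing)
  using (^-homo-*)

open ≡-Reasoning

-- The two series cannot be compared term by term: at y = N²/4 the numerator factor (j - 1/2)² - y
-- vanishes for j = (N+1)/2, so it is not close to its value at y = 0 in ratio, and the single terms
-- have no common factor p^r. On the right of the transformation both defects disappear. There y
-- occurs only in the factors j² - y with 0 < j < N, and p^r stands in front of the whole sum, so a
-- relative error of order p² inside costs only p^(r+2) outside.
--
-- The value N²/4 meets three demands: it is p-adically small beside j² for 0 < j < N; it is (m' +
-- a)² for the natural number m' = (N+1)/2 < N, so that the left side stops before the truncation at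
-- N; and, N being odd, it is never the square of an integer, so no denominator vanishes.
--
-- The hypergeometric parameters a ± √y and 1 ± √y enter only in pairs, through (j + a)² - y and j²
-- - y, so no square root is ever taken.

ring : AlmostCommutativeRing 0ℓ 0ℓ
ring = fromCommutativeRing +-*-commutativeRing (λ x → dec⇒maybe (0ℚ ≟ x))

-- The integers inside the rationals

ι : ℤ → ℚ
ι z = z / 1

-- `z / 1` is normalised through a gcd that does not reduce for a variable z. Identities about `ι`
-- are therefore checked among unnormalised rationals, where the image of z is `mkℚᵘ z 0`.
toℚᵘ-ι : ∀ z → toℚᵘ (ι z) ℚᵘ.≃ mkℚᵘ z 0
toℚᵘ-ι z = toℚᵘ-fromℚᵘ (mkℚᵘ z 0)

ι-injective : ∀ {x y} → ι x ≡ ι y → x ≡ y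
ι-injective {x} {y} eq with fromℚᵘ-injective {mkℚᵘ x 0} {mkℚᵘ y 0} eq
... | *≡* p = ℤ.*-cancelʳ-≡ x y (+ 1) p

ι-+ : ∀ x y → ι (x ℤ.+ y) ≡ ι x + ι y
ι-+ x y = toℚᵘ-injective (ℚᵘ.≃-trans (toℚᵘ-ι (x ℤ.+ y)) (ℚᵘ.≃-trans sum≃
  (ℚᵘ.≃-sym (ℚᵘ.≃-trans (toℚᵘ-homo-+ (ι x) (ι y)) (ℚᵘ.+-cong (toℚᵘ-ι x) (toℚᵘ-ι y))))))
  where
  sum≃ : mkℚᵘ (x ℤ.+ y) 0 ℚᵘ.≃ mkℚᵘ x 0 ℚᵘ.+ mkℚᵘ y 0
  sum≃ = *≡* (cong (ℤ._* + 1) (cong₂ ℤ._+_ (sym (ℤ.*-identityʳ x)) (sym (ℤ.*-identityʳ y))))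

ι-* : ∀ x y → ι (x ℤ.* y) ≡ ι x * ι y
ι-* x y = toℚᵘ-injective (ℚᵘ.≃-trans (toℚᵘ-ι (x ℤ.* y))
  (ℚᵘ.≃-sym (ℚᵘ.≃-trans (toℚᵘ-homo-* (ι x) (ι y)) (ℚᵘ.*-cong (toℚᵘ-ι x) (toℚᵘ-ι y)))))

ι-pos-* : ∀ m n → ι (+ m) * ι (+ n) ≡ ι (+ (m ℕ.* n))
ι-pos-* m n = trans (sym (ι-* (+ m) (+ n))) (cong ι (sym (ℤ.pos-* m n)))

ι-neg : ∀ x → ι (ℤ.- x) ≡ - ι x
ι-neg x = begin
  ι (ℤ.- x)                    ≡⟨ uncancel (ι (ℤ.- x)) (ι x) ⟩
  (ι (ℤ.- x) + ι x) - ι x      ≡⟨ cong (_- ι x) (ι-+ (ℤ.- x) x) ⟨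
  ι (ℤ.- x ℤ.+ x) - ι x        ≡⟨ cong (λ z → ι z - ι x) (ℤ.+-inverseˡ x) ⟩
  0ℚ - ι x                     ≡⟨ +-identityˡ (- ι x) ⟩
  - ι x                        ∎
  where
  uncancel : ∀ u v → u ≡ u + v - v
  uncancel = solve-∀ ring

ι-suc : ∀ n → ι (+ suc n) ≡ ι (+ n) + 1ℚ
ι-suc n = trans (cong (λ k → ι (+ k)) (ℕ.+-comm 1 n)) (ι-+ (+ n) (+ 1))

-- Finite sums

Σ< : ℕ → (ℕ → ℚ) → ℚ
Σ< zero    f = 0ℚ
Σ< (suc n) f = Σ< n f + f n

-- The sum over `Fin n` unfolds at its first term, `Σ<` at its last; inductions on the truncation
-- point need the latter.
∑≡Σ< : ∀ n (f : ℕ → ℚ) → ∑[ k < n ] f (toℕ k) ≡ Σ< n f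
∑≡Σ< zero    f = refl
∑≡Σ< (suc n) f = trans
  (sum-init-last +-0-commutativeMonoid {n} (f ∘ toℕ))
  (cong₂ _+_
    (trans (sum-cong-≗ +-0-commutativeMonoid {n} (λ i → cong f (toℕ-inject₁ i))) (∑≡Σ< n f))
    (cong f (toℕ-fromℕ n)))

Σ<-cong : ∀ n {f g : ℕ → ℚ} → (∀ k → k ℕ.< n → f k ≡ g k) → Σ< n f ≡ Σ< n g
Σ<-cong zero    eq = refl
Σ<-cong (suc n) eq =
  cong₂ _+_ (Σ<-cong n (λ k k<n → eq k (ℕ.m<n⇒m<1+n k<n))) (eq n (ℕ.n<1+n n))

Σ<-+ : ∀ n f g → Σ< n (λ k → f k + g k) ≡ Σ< n f + Σ< n g
Σ<-+ zero    f g = refl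
Σ<-+ (suc n) f g = trans (cong (_+ (f n + g n)) (Σ<-+ n f g)) (swap (Σ< n f) (Σ< n g) (f n) (g n))
  where
  swap : ∀ s t u v → (s + t) + (u + v) ≡ (s + u) + (t + v)
  swap = solve-∀ ring

Σ<-- : ∀ n f g → Σ< n (λ k → f k - g k) ≡ Σ< n f - Σ< n g
Σ<-- zero    f g = refl
Σ<-- (suc n) f g = trans (cong (_+ (f n - g n)) (Σ<-- n f g)) (swap (Σ< n f) (Σ< n g) (f n) (g n))
  where
  swap : ∀ s t u v → (s - t) + (u - v) ≡ (s + u) - (t + v)
  swap = solve-∀ ring

Σ<-*ˡ : ∀ n c f → Σ< n (λ k → c * f k) ≡ c * Σ< n f
Σ<-*ˡ zero    c f = sym (*-zeroʳ c)
Σ<-*ˡ (suc n) c f = trans (cong (_+ c * f n) (Σ<-*ˡ n c f)) (sym (*-distribˡ-+ c (Σ< n f) (f n)))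

Σ<-vanishing : ∀ {n m} {f : ℕ → ℚ} → n ℕ.≤′ m → (∀ k → n ≤ k → f k ≡ 0ℚ) → Σ< m f ≡ Σ< n f
Σ<-vanishing ℕ.≤′-refl _ = refl
Σ<-vanishing {n} {suc m} {f} (ℕ.≤′-step n≤m) f≡0 = begin
  Σ< m f + f m   ≡⟨ cong₂ _+_ (Σ<-vanishing n≤m f≡0) (f≡0 m (ℕ.≤′⇒≤ n≤m)) ⟩
  Σ< n f + 0ℚ    ≡⟨ +-identityʳ (Σ< n f) ⟩
  Σ< n f         ∎

-- Reciprocals and the quotients (a)_k / k!

recip : ℕ → ℚ
recip k = (1/ ι (+ suc k)) {{pos⇒nonZero (ι (+ suc k)) {{normalize-pos (suc k) 1}}}}

recip-inverse : ∀ k → recip k * ι (+ suc k) ≡ 1ℚ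
recip-inverse k = *-inverseˡ (ι (+ suc k)) {{pos⇒nonZero (ι (+ suc k)) {{normalize-pos (suc k) 1}}}}

inverse : ∀ x → x ≢ 0ℚ → ℚ
inverse x x≢0 = (1/ x) {{≢-nonZero x≢0}}

inverse-inverseˡ : ∀ x (x≢0 : x ≢ 0ℚ) → inverse x x≢0 * x ≡ 1ℚ
inverse-inverseˡ x x≢0 = *-inverseˡ x {{≢-nonZero x≢0}}

rising-shift : ∀ a n → rising a (suc n) ≡ a * rising (a + 1ℚ) n
rising-shift a zero    = base a
  where
  base : ∀ a → 1ℚ * (a + 0ℚ) ≡ a * 1ℚ
  base = solve-∀ ring
rising-shift a (suc n) = trans
  (cong₂ (λ u v → u * (a + v)) (rising-shift a n) (ι-suc n))
  (step a (rising (a + 1ℚ) n) (ι (+ n)))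
  where
  step : ∀ a u k → a * u * (a + (k + 1ℚ)) ≡ a * (u * (a + 1ℚ + k))
  step = solve-∀ ring

-- This is (a)_k / k!, or (-1)^k times the binomial coefficient of -a over k. The quotient is kept
-- as one quantity because it is p-integral for the values of a that matter, while 1/k! is not.
rising! : ℚ → ℕ → ℚ
rising! a zero    = 1ℚ
rising! a (suc k) = rising! a k * ((a + ι (+ k)) * recip k)

rising!-suc : ∀ a k → rising! a (suc k) * ι (+ suc k) ≡ rising! a k * (a + ι (+ k))
rising!-suc a k = begin
  rising! a k * ((a + ι (+ k)) * recip k) * ι (+ suc k)
    ≡⟨ assoc (rising! a k) (a + ι (+ k)) (recip k) (ι (+ suc k)) ⟩
  rising! a k * (a + ι (+ k)) * (recip k * ι (+ suc k))
    ≡⟨ cong (rising! a k * (a + ι (+ k)) *_) (recip-inverse k) ⟩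
  rising! a k * (a + ι (+ k)) * 1ℚ
    ≡⟨ *-identityʳ _ ⟩
  rising! a k * (a + ι (+ k)) ∎
  where
  assoc : ∀ s t u v → s * (t * u) * v ≡ s * t * (u * v)
  assoc = solve-∀ ring

rising!-shift : ∀ a k → rising! a (suc k) ≡ a * (rising! (a + 1ℚ) k * recip k)
rising!-shift a zero    = base a (recip 0)
  where
  base : ∀ a r → 1ℚ * ((a + 0ℚ) * r) ≡ a * (1ℚ * r)
  base = solve-∀ ring
rising!-shift a (suc k) = trans
  (cong₂ (λ u v → u * ((a + v) * recip (suc k))) (rising!-shift a k) (ι-suc k))
  (step a (rising! (a + 1ℚ) k) (ι (+ k)) (recip k) (recip (suc k)))
  where
  step : ∀ a u k r r′ →
    a * (u * r) * ((a + (k + 1ℚ)) * r′) ≡ a * (u * ((a + 1ℚ + k) * r) * r′)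
  step = solve-∀ ring

rising≡rising!*rising : ∀ a k → rising a k ≡ rising! a k * rising 1ℚ k
rising≡rising!*rising a zero    = refl
rising≡rising!*rising a (suc k) = begin
  rising a k * (a + κ)                                  ≡⟨ cong (_* (a + κ)) (rising≡rising!*rising a k) ⟩
  rising! a k * rising 1ℚ k * (a + κ)                   ≡⟨ swap (rising! a k) (rising 1ℚ k) (a + κ) ⟩
  rising! a k * (a + κ) * rising 1ℚ k                   ≡⟨ cong (_* rising 1ℚ k) (rising!-suc a k) ⟨
  rising! a (suc k) * ι (+ suc k) * rising 1ℚ k         ≡⟨ cong (λ u → rising! a (suc k) * u * rising 1ℚ k) (ι-suc k) ⟩
  rising! a (suc k) * (κ + 1ℚ) * rising 1ℚ k            ≡⟨ reorder (rising! a (suc k)) κ (rising 1ℚ k) ⟩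
  rising! a (suc k) * (rising 1ℚ k * (1ℚ + κ))          ∎
  where
  κ = ι (+ k)
  swap : ∀ s t u → s * t * u ≡ s * u * t
  swap = solve-∀ ring
  reorder : ∀ s k t → s * (k + 1ℚ) * t ≡ s * (t * (1ℚ + k))
  reorder = solve-∀ ring

*-cancelˡ-inverse : ∀ i c x y → i * c ≡ 1ℚ → c * x ≡ c * y → x ≡ y
*-cancelˡ-inverse i c x y ic≡1 cx≡cy = begin
  x            ≡⟨ expand x ⟩
  i * (c * x)  ≡⟨ cong (i *_) cx≡cy ⟩
  i * (c * y)  ≡⟨ expand y ⟨
  y            ∎
  where
  expand : ∀ z → z ≡ i * (c * z)
  expand z = trans (sym (*-identityˡ z)) (trans (cong (_* z) (sym ic≡1)) (*-assoc i c z))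

-- Coefficient of z^m in (1 - z)^(a-1) (1 - z)^(-a) = 1/(1 - z). The sum stays the same from m to m
-- + 1: the difference of the summands telescopes, its sum over all indices below k being -k `w k`
-- `β (suc m ∸ k)` / (m + 1), and at k = m + 1 this cancels the new summand.
rising!-vandermonde : ∀ a m → Σ< (suc m) (λ k → rising! (1ℚ - a) k * rising! a (m ℕ.∸ k)) ≡ 1ℚ
rising!-vandermonde a zero    = refl
rising!-vandermonde a (suc m) = begin
  Σ< (suc m) (conv (suc m)) + w (suc m) * β (m ℕ.∸ m)
    ≡⟨ regroup (Σ< (suc m) (conv (suc m))) (Σ< (suc m) (conv m)) (w (suc m) * β (m ℕ.∸ m)) ⟩
  (Σ< (suc m) (conv (suc m)) - Σ< (suc m) (conv m)) + w (suc m) * β (m ℕ.∸ m) + Σ< (suc m) (conv m)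
    ≡⟨ cong₂ (λ u v → u + w (suc m) * β (m ℕ.∸ m) + v)
         (trans (sym (Σ<-- (suc m) (conv (suc m)) (conv m))) telescoped)
         (rising!-vandermonde a m) ⟩
  - (w (suc m) * β (m ℕ.∸ m)) + w (suc m) * β (m ℕ.∸ m) + 1ℚ
    ≡⟨ cong (_+ 1ℚ) (+-inverseˡ (w (suc m) * β (m ℕ.∸ m))) ⟩
  1ℚ ∎
  where
  w β : ℕ → ℚ
  w = rising! (1ℚ - a)
  β = rising! a

  conv : ℕ → ℕ → ℚ
  conv n k = w k * β (n ℕ.∸ k)

  regroup : ∀ u v x → u + x ≡ u - v + x + v
  regroup = solve-∀ ring

  step-algebra : ∀ a k j w w′ β β′ S k′ j′ n → k′ ≡ k + 1ℚ → j′ ≡ j + 1ℚ → n ≡ k + j + 1ℚ →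
    w′ * k′ ≡ w * (1ℚ - a + k) → β′ * j′ ≡ β * (a + j) → S * n ≡ - (k * w * β′) →
    (S + (w * β′ - w * β)) * n ≡ - (k′ * w′ * β)
  step-algebra a k j w w′ β β′ S k′ j′ n refl refl refl eqw eqβ eqS = begin
    (S + (w * β′ - w * β)) * (k + j + 1ℚ)
      ≡⟨ expand₁ S w β β′ k j ⟩
    S * (k + j + 1ℚ) + (w * k * β′ + w * (β′ * (j + 1ℚ)) - w * β * (k + j + 1ℚ))
      ≡⟨ cong₂ (λ u v → u + (w * k * β′ + w * v - w * β * (k + j + 1ℚ))) eqS eqβ ⟩
    - (k * w * β′) + (w * k * β′ + w * (β * (a + j)) - w * β * (k + j + 1ℚ))
      ≡⟨ expand₂ a w β β′ k j ⟩
    - (w * (1ℚ - a + k) * β)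
      ≡⟨ cong (λ u → - (u * β)) eqw ⟨
    - (w′ * k′ * β)
      ≡⟨ cong (λ u → - (u * β)) (*-comm w′ k′) ⟩
    - (k′ * w′ * β) ∎
    where
    expand₁ : ∀ S w β β′ k j → (S + (w * β′ - w * β)) * (k + j + 1ℚ) ≡
      S * (k + j + 1ℚ) + (w * k * β′ + w * (β′ * (j + 1ℚ)) - w * β * (k + j + 1ℚ))
    expand₁ = solve-∀ ring
    expand₂ : ∀ a w β β′ k j →
      - (k * w * β′) + (w * k * β′ + w * (β * (a + j)) - w * β * (k + j + 1ℚ)) ≡
      - (w * (1ℚ - a + k) * β)
    expand₂ = solve-∀ ring

  telescope : ∀ k → k ≤ suc m →
    Σ< k (λ k → conv (suc m) k - conv m k) * ι (+ suc m) ≡ - (ι (+ k) * w k * β (suc m ℕ.∸ k))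
  telescope zero    _    = base (ι (+ suc m)) (w 0) (β (suc m))
    where
    base : ∀ n u v → 0ℚ * n ≡ - (0ℚ * u * v)
    base = solve-∀ ring
  telescope (suc k) (ℕ.s≤s k≤m) =
    step-algebra a (ι (+ k)) (ι (+ (m ℕ.∸ k))) (w k) (w (suc k)) (β (m ℕ.∸ k)) (β (suc m ℕ.∸ k))
      (Σ< k (λ k → conv (suc m) k - conv m k)) (ι (+ suc k)) (ι (+ suc (m ℕ.∸ k))) (ι (+ suc m))
      (ι-suc k) (ι-suc (m ℕ.∸ k)) suc-m
      (rising!-suc (1ℚ - a) k)
      (trans (cong (λ n → β n * ι (+ suc (m ℕ.∸ k))) (ℕ.+-∸-assoc 1 k≤m)) (rising!-suc a (m ℕ.∸ k)))
      (telescope k (ℕ.m≤n⇒m≤1+n k≤m))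
    where
    suc-m : ι (+ suc m) ≡ ι (+ k) + ι (+ (m ℕ.∸ k)) + 1ℚ
    suc-m = trans (ι-suc m) (cong (_+ 1ℚ)
      (trans (cong (λ n → ι (+ n)) (sym (ℕ.m+[n∸m]≡n k≤m))) (ι-+ (+ k) (+ (m ℕ.∸ k)))))

  telescoped : Σ< (suc m) (λ k → conv (suc m) k - conv m k) ≡ - (w (suc m) * β (m ℕ.∸ m))
  telescoped = *-cancelˡ-inverse (recip m) (ι (+ suc m))
    (Σ< (suc m) (λ k → conv (suc m) k - conv m k)) (- (w (suc m) * β (m ℕ.∸ m))) (recip-inverse m)
    (trans (*-comm (ι (+ suc m)) (Σ< (suc m) (λ k → conv (suc m) k - conv m k)))
    (trans (telescope (suc m) ℕ.≤-refl) (pull (ι (+ suc m)) (w (suc m)) (β (m ℕ.∸ m)))))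
    where
    pull : ∀ n u v → - (n * u * v) ≡ n * - (u * v)
    pull = solve-∀ ring

rising-neg-vanishes : ∀ {m n} → m ℕ.<′ n → rising (- ι (+ m)) n ≡ 0ℚ
rising-neg-vanishes {m} ℕ.<′-base = trans
  (cong (rising (- ι (+ m)) m *_) (+-inverseˡ (ι (+ m)))) (*-zeroʳ (rising (- ι (+ m)) m))
rising-neg-vanishes {m} {suc n} (ℕ.≤′-step m<n) = trans
  (cong (_* (- ι (+ m) + ι (+ n))) (rising-neg-vanishes m<n)) (*-zeroˡ (- ι (+ m) + ι (+ n)))

-- Whipple's transformation

-- The reciprocals of (k+1)² - y come as a parameter because they exist for different reasons: at y
-- = 0 they are squares of `recip`, at y = N²/4 they rest on N being odd.
module TruncatedWhipple
  (a y : ℚ) (i : ℕ → ℚ)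
  (i-inverse : ∀ k → i k * (ι (+ suc k) * ι (+ suc k) - y) ≡ 1ℚ)
  where

  -- With y = b², `e k` is (a+b)_k (a-b)_k and `ρ k` is 1 / ((1+b)_k (1-b)_k). The factor a + 2k
  -- makes `t` the general term of a very well-poised series with argument -1.
  e ρ t : ℕ → ℚ
  e zero    = 1ℚ
  e (suc k) = e k * ((ι (+ k) + a) * (ι (+ k) + a) - y)
  ρ zero    = 1ℚ
  ρ (suc k) = ρ k * i k
  t k = (a + (ι (+ k) + ι (+ k))) * ((- 1ℚ) ^ k * rising! a k * e k * ρ k)

  saalschützTerm whippleTerm : ℕ → ℕ → ℚ
  saalschützTerm m k = rising (- ι (+ m)) k * rising (ι (+ m) + a) k * rising! (1ℚ - a) k
  whippleTerm    m k = rising (- ι (+ m)) k * rising (ι (+ suc m) + a) k * rising! (1ℚ - a) k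

  ρ-step : ∀ k → ρ k ≡ ρ (suc k) * (ι (+ suc k) * ι (+ suc k) - y)
  ρ-step k = begin
    ρ k                 ≡⟨ *-identityʳ (ρ k) ⟨
    ρ k * 1ℚ            ≡⟨ cong (ρ k *_) (i-inverse k) ⟨
    ρ k * (i k * _)     ≡⟨ *-assoc (ρ k) (i k) _ ⟨
    ρ k * i k * _       ∎

  zero-product : ∀ {x} u v → x ≡ 0ℚ → x * u * v ≡ 0ℚ
  zero-product u v refl = identity u v
    where
    identity : ∀ u v → 0ℚ * u * v ≡ 0ℚ
    identity = solve-∀ ring

  saalschützTerm-vanishes : ∀ {m k} → m ℕ.<′ k → saalschützTerm m k ≡ 0ℚ
  saalschützTerm-vanishes {m} {k} m<k =
    zero-product (rising (ι (+ m) + a) k) (rising! (1ℚ - a) k) (rising-neg-vanishes m<k)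

  whippleTerm-vanishes : ∀ {m k} → m ℕ.<′ k → whippleTerm m k ≡ 0ℚ
  whippleTerm-vanishes {m} {k} m<k =
    zero-product (rising (ι (+ suc m) + a) k) (rising! (1ℚ - a) k) (rising-neg-vanishes m<k)

  Σ-extend : ∀ {T : ℕ → ℕ → ℚ} → (∀ {m k} → m ℕ.<′ k → T m k ≡ 0ℚ) → ∀ m →
    Σ< (suc (suc m)) (λ k → T m k * ρ k) ≡ Σ< (suc m) (λ k → T m k * ρ k)
  Σ-extend {T} T≡0 m = Σ<-vanishing {f = λ k → T m k * ρ k} (ℕ.≤′-step ℕ.≤′-refl)
    (λ k m<k → trans (cong (_* ρ k) (T≡0 (ℕ.≤⇒≤′ m<k))) (*-zeroˡ (ρ k)))

  rising-neg-suc : ∀ m k →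
    rising (- ι (+ suc m)) (suc k) ≡ (- ι (+ m) - 1ℚ) * rising (- ι (+ m)) k
  rising-neg-suc m k = trans (rising-shift (- ι (+ suc m)) k)
    (cong₂ (λ u v → u * rising v k) -suc (trans (cong (_+ 1ℚ) -suc) (cancel (ι (+ m)))))
    where
    -suc : - ι (+ suc m) ≡ - ι (+ m) - 1ℚ
    -suc = trans (cong -_ (ι-suc m)) (neg-distrib-+ (ι (+ m)) 1ℚ)
    cancel : ∀ u → - u - 1ℚ + 1ℚ ≡ - u
    cancel = solve-∀ ring

  rising-+-suc : ∀ m k → rising (ι (+ m) + a) (suc k) ≡ (ι (+ m) + a) * rising (ι (+ suc m) + a) k
  rising-+-suc m k = trans (rising-shift (ι (+ m) + a) k) (cong (λ u → (ι (+ m) + a) * rising u k)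
    (trans (swap (ι (+ m)) a) (cong (_+ a) (sym (ι-suc m)))))
    where
    swap : ∀ μ a → μ + a + 1ℚ ≡ μ + 1ℚ + a
    swap = solve-∀ ring

  -- Both sides of saalschütz satisfy A(m) x(m+1) = B(m) x(m); since y ρ(k) = k² ρ(k) - ρ(k-1), the
  -- difference A S(m+1) - B S(m) of the right-hand sums telescopes.
  saalschütz-telescope : ∀ m n →
    Σ< (suc n) (λ k → (((ι (+ m) + 1ℚ) * (ι (+ m) + 1ℚ) - y) * saalschützTerm (suc m) k
                     - ((ι (+ m) + a) * (ι (+ m) + a) - y) * saalschützTerm m k) * ρ k)
    ≡ - (saalschützTerm (suc m) (suc n) - saalschützTerm m (suc n)) * ρ n
  saalschütz-telescope m zero    = trans (base₁ (ι (+ m)) a y) (cong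
      (λ s → - (1ℚ * (- s + 0ℚ) * (1ℚ * (s + a + 0ℚ)) * (1ℚ * ((1ℚ - a + 0ℚ) * 1ℚ))
              - 1ℚ * (- ι (+ m) + 0ℚ) * (1ℚ * (ι (+ m) + a + 0ℚ)) * (1ℚ * ((1ℚ - a + 0ℚ) * 1ℚ))) * 1ℚ)
      (sym (ι-suc m)))
    where
    base₁ : ∀ μ a y →
      0ℚ + (((μ + 1ℚ) * (μ + 1ℚ) - y) * (1ℚ * 1ℚ * 1ℚ) - ((μ + a) * (μ + a) - y) * (1ℚ * 1ℚ * 1ℚ)) * 1ℚ
      ≡ - (1ℚ * (- (μ + 1ℚ) + 0ℚ) * (1ℚ * (μ + 1ℚ + a + 0ℚ)) * (1ℚ * ((1ℚ - a + 0ℚ) * 1ℚ))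
          - 1ℚ * (- μ + 0ℚ) * (1ℚ * (μ + a + 0ℚ)) * (1ℚ * ((1ℚ - a + 0ℚ) * 1ℚ))) * 1ℚ
    base₁ = solve-∀ ring
  saalschütz-telescope m (suc n) = trans
    (cong (λ u → u + (((ι (+ m) + 1ℚ) * (ι (+ m) + 1ℚ) - y) * saalschützTerm (suc m) (suc n)
                     - ((ι (+ m) + a) * (ι (+ m) + a) - y) * saalschützTerm m (suc n)) * ρ (suc n))
      (saalschütz-telescope m n))
    (step (ι (+ m)) (ι (+ n)) (rising (- ι (+ m)) n) (rising (ι (+ suc m) + a) n) (ρ (suc n))
      (w (suc n) * recip (suc n)) (ι (+ suc m)) (ι (+ suc n)) (ι (+ suc (suc n)))
      (rising (- ι (+ suc m)) (suc n)) (rising (- ι (+ suc m)) (suc (suc n)))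
      (rising (ι (+ m) + a) (suc n)) (rising (ι (+ m) + a) (suc (suc n)))
      (w (suc n)) (w (suc (suc n))) (ρ n)
      (ι-suc m) (ι-suc n) (ι-suc (suc n)) (rising-neg-suc m n) (rising-neg-suc m (suc n))
      (rising-+-suc m n) (rising-+-suc m (suc n)) w-eq (shuffle (w (suc n)) (1ℚ - a + ι (+ suc n)) (recip (suc n)))
      (ρ-step n))
    where
    w : ℕ → ℚ
    w = rising! (1ℚ - a)
    w-eq : w (suc n) ≡ w (suc n) * recip (suc n) * ι (+ suc (suc n))
    w-eq = trans (sym (*-identityʳ (w (suc n))))
      (trans (cong (w (suc n) *_) (sym (recip-inverse (suc n))))
        (sym (*-assoc (w (suc n)) (recip (suc n)) (ι (+ suc (suc n))))))
    shuffle : ∀ u x r → u * (x * r) ≡ u * r * x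
    shuffle = solve-∀ ring
    -- All terms are expressed by p, q, r, v, where v is `w (suc n)` divided by n + 2 and r is
    -- `ρ (suc n)`. In these the equations have no reciprocals left, and a polynomial identity
    -- remains.
    step : ∀ μ k p q r v M k₁ k₂ R′₁ R′₂ R₁ R₂ w₁ w₂ r₀ →
      M ≡ μ + 1ℚ → k₁ ≡ k + 1ℚ → k₂ ≡ k₁ + 1ℚ →
      R′₁ ≡ (- μ - 1ℚ) * p → R′₂ ≡ (- μ - 1ℚ) * (p * (- μ + k)) →
      R₁ ≡ (μ + a) * q → R₂ ≡ (μ + a) * (q * (M + a + k)) →
      w₁ ≡ v * k₂ → w₂ ≡ v * (1ℚ - a + k₁) → r₀ ≡ r * (k₁ * k₁ - y) →
      - (R′₁ * (q * (M + a + k)) * w₁ - p * (- μ + k) * R₁ * w₁) * r₀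
      + (((μ + 1ℚ) * (μ + 1ℚ) - y) * (R′₁ * (q * (M + a + k)) * w₁)
        - ((μ + a) * (μ + a) - y) * (p * (- μ + k) * R₁ * w₁)) * r
      ≡ - (R′₂ * (q * (M + a + k) * (M + a + k₁)) * w₂ - p * (- μ + k) * (- μ + k₁) * R₂ * w₂) * r
    step μ k p q r v _ _ _ _ _ _ _ _ _ _ refl refl refl refl refl refl refl refl refl refl =
      identity μ k p q r v a y
      where
      identity : ∀ μ k p q r v a y →
        - ((- μ - 1ℚ) * p * (q * (μ + 1ℚ + a + k)) * (v * (k + 1ℚ + 1ℚ))
          - p * (- μ + k) * ((μ + a) * q) * (v * (k + 1ℚ + 1ℚ))) * (r * ((k + 1ℚ) * (k + 1ℚ) - y))
        + (((μ + 1ℚ) * (μ + 1ℚ) - y) * ((- μ - 1ℚ) * p * (q * (μ + 1ℚ + a + k)) * (v * (k + 1ℚ + 1ℚ)))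
          - ((μ + a) * (μ + a) - y) * (p * (- μ + k) * ((μ + a) * q) * (v * (k + 1ℚ + 1ℚ)))) * r
        ≡ - ((- μ - 1ℚ) * (p * (- μ + k)) * (q * (μ + 1ℚ + a + k) * (μ + 1ℚ + a + (k + 1ℚ))) * (v * (1ℚ - a + (k + 1ℚ)))
          - p * (- μ + k) * (- μ + (k + 1ℚ)) * ((μ + a) * (q * (μ + 1ℚ + a + k))) * (v * (1ℚ - a + (k + 1ℚ)))) * r
      identity = solve-∀ ring

  -- The Pfaff-Saalschütz theorem: with y = b² the right side is the balanced series 3F2(-m, m+a,
  -- 1-a; 1+b, 1-b; 1).
  saalschütz : ∀ m → e m * ρ m ≡ Σ< (suc m) (λ k → saalschützTerm m k * ρ k)
  saalschütz zero    = refl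
  saalschütz (suc m) = sym (*-cancelˡ-inverse (i m) A S′ (e (suc m) * ρ (suc m)) i*A≡1 (begin
    A * S′                                        ≡⟨ split (A * S′) (B * S) ⟩
    (A * S′ - B * S) + B * S                      ≡⟨ cong₂ _+_ difference (cong (B *_) (sym S≡eρ)) ⟩
    0ℚ + B * (e m * ρ m)                          ≡⟨ cong (λ u → 0ℚ + B * (e m * u)) ρ≡ ⟩
    0ℚ + B * (e m * (ρ (suc m) * A))              ≡⟨ reorder A B (e m) (ρ (suc m)) ⟩
    A * (e (suc m) * ρ (suc m))                   ∎))
    where
    A B S S′ : ℚ
    A  = (ι (+ m) + 1ℚ) * (ι (+ m) + 1ℚ) - y
    B  = (ι (+ m) + a) * (ι (+ m) + a) - y
    -- One term longer than in `saalschütz m`, so that S and S′ have the same range; the extra term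
    -- contains (-m)_(m+1) = 0.
    S  = Σ< (suc (suc m)) (λ k → saalschützTerm m k * ρ k)
    S′ = Σ< (suc (suc m)) (λ k → saalschützTerm (suc m) k * ρ k)

    A≡ : ι (+ suc m) * ι (+ suc m) - y ≡ A
    A≡ = cong (λ u → u * u - y) (ι-suc m)
    i*A≡1 : i m * A ≡ 1ℚ
    i*A≡1 = trans (cong (i m *_) (sym A≡)) (i-inverse m)
    ρ≡ : ρ m ≡ ρ (suc m) * A
    ρ≡ = trans (ρ-step m) (cong (ρ (suc m) *_) A≡)

    split : ∀ u v → u ≡ u - v + v
    split = solve-∀ ring
    reorder : ∀ A B u v → 0ℚ + B * (u * (v * A)) ≡ A * (u * B * v)
    reorder = solve-∀ ring

    S≡eρ : e m * ρ m ≡ S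
    S≡eρ = trans (saalschütz m) (sym (Σ-extend saalschützTerm-vanishes m))

    difference : A * S′ - B * S ≡ 0ℚ
    difference = begin
      A * S′ - B * S
        ≡⟨ cong₂ _-_ (sym (Σ<-*ˡ (suc (suc m)) A (λ k → saalschützTerm (suc m) k * ρ k)))
                     (sym (Σ<-*ˡ (suc (suc m)) B (λ k → saalschützTerm m k * ρ k))) ⟩
      Σ< (suc (suc m)) (λ k → A * (saalschützTerm (suc m) k * ρ k))
        - Σ< (suc (suc m)) (λ k → B * (saalschützTerm m k * ρ k))
        ≡⟨ Σ<-- (suc (suc m)) (λ k → A * (saalschützTerm (suc m) k * ρ k))
             (λ k → B * (saalschützTerm m k * ρ k)) ⟨
      Σ< (suc (suc m)) (λ k → A * (saalschützTerm (suc m) k * ρ k) - B * (saalschützTerm m k * ρ k))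
        ≡⟨ Σ<-cong (suc (suc m)) (λ k _ → factor A B (saalschützTerm (suc m) k) (saalschützTerm m k) (ρ k)) ⟩
      Σ< (suc (suc m)) (λ k → (A * saalschützTerm (suc m) k - B * saalschützTerm m k) * ρ k)
        ≡⟨ saalschütz-telescope m (suc m) ⟩
      - (saalschützTerm (suc m) (suc (suc m)) - saalschützTerm m (suc (suc m))) * ρ (suc m)
        ≡⟨ cong₂ (λ u v → - (u - v) * ρ (suc m))
             (saalschützTerm-vanishes {suc m} ℕ.<′-base)
             (saalschützTerm-vanishes {m} (ℕ.≤′-step ℕ.<′-base)) ⟩
      - (0ℚ - 0ℚ) * ρ (suc m)
        ≡⟨ *-zeroˡ (ρ (suc m)) ⟩
      0ℚ ∎
      where
      factor : ∀ A B u v r → A * (u * r) - B * (v * r) ≡ (A * u - B * v) * r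
      factor = solve-∀ ring

  whippleFactor : ℕ → ℚ
  whippleFactor m = (- 1ℚ) ^ m * (a * rising! (a + 1ℚ) m)

  -- Made for summation against `ρ`: the last coefficient is that of `e (suc m) * ρ (suc m)` in
  -- `t (suc m)`, and `saalschütz` turns the sum of the last terms into this product.
  whippleTerm-suc : ∀ m k →
    whippleFactor (suc m) * whippleTerm (suc m) k ≡
    whippleFactor m * whippleTerm m k
      + (a + (ι (+ suc m) + ι (+ suc m))) * ((- 1ℚ) ^ suc m * rising! a (suc m)) * saalschützTerm (suc m) k
  whippleTerm-suc m k = step (ι (+ m)) ((- 1ℚ) ^ m) (rising! (a + 1ℚ) m) (recip m)
    (rising (- ι (+ suc m)) k) (rising (- ι (+ m)) k) (rising (ι (+ suc m) + a) k)
    (rising (ι (+ suc (suc m)) + a) k) (rising! (1ℚ - a) k) (ι (+ k)) (ι (+ suc m)) (rising! a (suc m))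
    (ι-suc m) (rising!-shift a m) (rising-neg-suc m k) (sym (rising-+-suc (suc m) k)) (recip-inverse m)
    where
    step : ∀ μ σ b rc u P q Q w κ M α → M ≡ μ + 1ℚ → α ≡ a * (b * rc) →
      u * (- M + κ) ≡ (- μ - 1ℚ) * P → (M + a) * Q ≡ q * (M + a + κ) → rc * M ≡ 1ℚ →
      - 1ℚ * σ * (a * (b * ((a + 1ℚ + μ) * rc))) * (u * Q * w)
      ≡ σ * (a * b) * (P * q * w) + (a + (M + M)) * (- 1ℚ * σ * α) * (u * q * w)
    step μ σ b rc u P q Q w κ M α refl refl u≡ Q≡ rc≡ = begin
      - 1ℚ * σ * (a * (b * ((a + 1ℚ + μ) * rc))) * (u * Q * w)
        ≡⟨ collect-Q μ σ b rc u Q w a ⟩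
      - (σ * a * b * rc * u * w) * ((μ + 1ℚ + a) * Q)
        ≡⟨ cong (- (σ * a * b * rc * u * w) *_) Q≡ ⟩
      - (σ * a * b * rc * u * w) * (q * (μ + 1ℚ + a + κ))
        -- The whole identity rests on M + a + κ = (κ - M) + (a + 2M).
        ≡⟨ exchange μ σ b rc u q w κ a ⟩
      - (σ * a * b * rc * q * w) * (u * (- (μ + 1ℚ) + κ)) + (a + (M + M)) * (- 1ℚ * σ * α) * (u * q * w)
        ≡⟨ cong (λ v → - (σ * a * b * rc * q * w) * v + (a + (M + M)) * (- 1ℚ * σ * α) * (u * q * w)) u≡ ⟩
      - (σ * a * b * rc * q * w) * ((- μ - 1ℚ) * P) + (a + (M + M)) * (- 1ℚ * σ * α) * (u * q * w)
        ≡⟨ cong (_+ (a + (M + M)) * (- 1ℚ * σ * α) * (u * q * w)) (collect-rc μ σ b rc P q w a) ⟩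
      σ * a * b * q * w * P * (rc * (μ + 1ℚ)) + (a + (M + M)) * (- 1ℚ * σ * α) * (u * q * w)
        ≡⟨ cong (λ v → σ * a * b * q * w * P * v + (a + (M + M)) * (- 1ℚ * σ * α) * (u * q * w)) rc≡ ⟩
      σ * a * b * q * w * P * 1ℚ + (a + (M + M)) * (- 1ℚ * σ * α) * (u * q * w)
        ≡⟨ cong (_+ (a + (M + M)) * (- 1ℚ * σ * α) * (u * q * w)) (drop-one σ b P q w a) ⟩
      σ * (a * b) * (P * q * w) + (a + (M + M)) * (- 1ℚ * σ * α) * (u * q * w) ∎
      where
      collect-Q : ∀ μ σ b rc u Q w a → - 1ℚ * σ * (a * (b * ((a + 1ℚ + μ) * rc))) * (u * Q * w)
        ≡ - (σ * a * b * rc * u * w) * ((μ + 1ℚ + a) * Q)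
      collect-Q = solve-∀ ring
      exchange : ∀ μ σ b rc u q w κ a → - (σ * a * b * rc * u * w) * (q * (μ + 1ℚ + a + κ))
        ≡ - (σ * a * b * rc * q * w) * (u * (- (μ + 1ℚ) + κ))
          + (a + (μ + 1ℚ + (μ + 1ℚ))) * (- 1ℚ * σ * (a * (b * rc))) * (u * q * w)
      exchange = solve-∀ ring
      collect-rc : ∀ μ σ b rc P q w a → - (σ * a * b * rc * q * w) * ((- μ - 1ℚ) * P)
        ≡ σ * a * b * q * w * P * (rc * (μ + 1ℚ))
      collect-rc = solve-∀ ring
      drop-one : ∀ σ b P q w a → σ * a * b * q * w * P * 1ℚ ≡ σ * (a * b) * (P * q * w)
      drop-one = solve-∀ ring

  -- The limit case of Whipple's transformation that leads to a 3F2 has upper parameters -m and d.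
  -- For d = m + 1 + a these cancel against the lower parameters 1 + a - d = -m and 1 + a + m, so
  -- the terminating series becomes a partial sum.
  truncated-whipple : ∀ m → Σ< (suc m) t ≡ whippleFactor m * Σ< (suc m) (λ k → whippleTerm m k * ρ k)
  truncated-whipple zero    = base a
    where
    base : ∀ a → 0ℚ + (a + (0ℚ + 0ℚ)) * (1ℚ * 1ℚ * 1ℚ * 1ℚ) ≡ 1ℚ * (a * 1ℚ) * (0ℚ + 1ℚ * 1ℚ * 1ℚ * 1ℚ)
    base = solve-∀ ring
  truncated-whipple (suc m) = begin
    Σ< (suc m) t + b * ((- 1ℚ) ^ suc m * rising! a (suc m) * e (suc m) * ρ (suc m))
      ≡⟨ cong₂ _+_ (trans (truncated-whipple m) (cong (c *_) (sym (Σ-extend whippleTerm-vanishes m))))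
           (reassoc b ((- 1ℚ) ^ suc m) (rising! a (suc m)) (e (suc m)) (ρ (suc m))) ⟩
    c * Σ< n (λ k → whippleTerm m k * ρ k) + d * (e (suc m) * ρ (suc m))
      ≡⟨ cong (λ u → c * Σ< n (λ k → whippleTerm m k * ρ k) + d * u) (saalschütz (suc m)) ⟩
    c * Σ< n (λ k → whippleTerm m k * ρ k) + d * Σ< n (λ k → saalschützTerm (suc m) k * ρ k)
      ≡⟨ cong₂ _+_ (Σ<-*ˡ n c (λ k → whippleTerm m k * ρ k))
                   (Σ<-*ˡ n d (λ k → saalschützTerm (suc m) k * ρ k)) ⟨
    Σ< n (λ k → c * (whippleTerm m k * ρ k)) + Σ< n (λ k → d * (saalschützTerm (suc m) k * ρ k))
      ≡⟨ Σ<-+ n (λ k → c * (whippleTerm m k * ρ k)) (λ k → d * (saalschützTerm (suc m) k * ρ k)) ⟨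
    Σ< n (λ k → c * (whippleTerm m k * ρ k) + d * (saalschützTerm (suc m) k * ρ k))
      ≡⟨ Σ<-cong n (λ k _ → trans
           (factor c d (whippleTerm m k) (saalschützTerm (suc m) k) (ρ k))
           (trans (cong (_* ρ k) (sym (whippleTerm-suc m k)))
             (*-assoc (whippleFactor (suc m)) (whippleTerm (suc m) k) (ρ k)))) ⟩
    Σ< n (λ k → whippleFactor (suc m) * (whippleTerm (suc m) k * ρ k))
      ≡⟨ Σ<-*ˡ n (whippleFactor (suc m)) (λ k → whippleTerm (suc m) k * ρ k) ⟩
    whippleFactor (suc m) * Σ< n (λ k → whippleTerm (suc m) k * ρ k) ∎
    where
    n : ℕ
    n = suc (suc m)
    b c d : ℚ
    b = a + (ι (+ suc m) + ι (+ suc m))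
    c = whippleFactor m
    d = b * ((- 1ℚ) ^ suc m * rising! a (suc m))
    reassoc : ∀ b σ α e r → b * (σ * α * e * r) ≡ b * (σ * α) * (e * r)
    reassoc = solve-∀ ring
    factor : ∀ c d u v r → c * (u * r) + d * (v * r) ≡ (c * u + d * v) * r
    factor = solve-∀ ring

-- Evaluation at y = (m + a)²

module TerminatingWhipple
  (a : ℚ) (m : ℕ) (i : ℕ → ℚ)
  (i-inverse : ∀ k → i k * (ι (+ suc k) * ι (+ suc k) - (ι (+ m) + a) * (ι (+ m) + a)) ≡ 1ℚ)
  where

  open TruncatedWhipple a ((ι (+ m) + a) * (ι (+ m) + a)) i i-inverse public

  e-vanishes : ∀ {k} → m ℕ.<′ k → e k ≡ 0ℚ
  e-vanishes ℕ.<′-base = trans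
    (cong (e m *_) (+-inverseʳ ((ι (+ m) + a) * (ι (+ m) + a)))) (*-zeroʳ (e m))
  e-vanishes {suc k} (ℕ.≤′-step m<k) = trans (cong (_* factor) (e-vanishes m<k)) (*-zeroˡ factor)
    where
    factor = (ι (+ k) + a) * (ι (+ k) + a) - (ι (+ m) + a) * (ι (+ m) + a)

  t-vanishes : ∀ {k} → m ℕ.< k → t k ≡ 0ℚ
  t-vanishes {k} m<k = trans
    (cong (λ u → (a + (ι (+ k) + ι (+ k))) * ((- 1ℚ) ^ k * rising! a k * u * ρ k))
      (e-vanishes (ℕ.≤⇒≤′ m<k)))
    (identity (a + (ι (+ k) + ι (+ k))) ((- 1ℚ) ^ k) (rising! a k) (ρ k))
    where
    identity : ∀ s u v r → s * (u * v * 0ℚ * r) ≡ 0ℚ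
    identity = solve-∀ ring

  -- For y = (m + a)² the parameter m + 1 + a of the numerator cancels against the denominator.
  cancelled-factor : ∀ k j → k ℕ.+ j ≡ m →
    rising (- ι (+ m)) k * rising (ι (+ suc m) + a) k * ρ k * rising! a m ≡ rising! a j
  cancelled-factor zero    j refl = *-identityˡ (rising! a j)
  cancelled-factor (suc k) j k+j≡m = step
    (rising (- ι (+ m)) k) (rising (ι (+ suc m) + a) k) (ρ k) (i k) (rising! a m) (rising! a j) (rising! a (suc j))
    (ι (+ k)) (ι (+ j)) (ι (+ m)) (ι (+ suc m)) (ι (+ suc k)) (ι (+ suc j))
    (ι-suc m) (ι-suc k) (ι-suc j)
    (trans (cong (λ n → ι (+ n)) (trans (sym k+j≡m) (sym (ℕ.+-suc k j))))
      (trans (ι-+ (+ k) (+ suc j)) (cong (λ u → ι (+ k) + u) (ι-suc j))))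
    (i-inverse k) (rising!-suc a j)
    (cancelled-factor k (suc j) (trans (ℕ.+-suc k j) k+j≡m))
    where
    step : ∀ u q r i α β β′ κ j μ M k′ j′ →
      M ≡ μ + 1ℚ → k′ ≡ κ + 1ℚ → j′ ≡ j + 1ℚ → μ ≡ κ + (j + 1ℚ) →
      i * (k′ * k′ - (μ + a) * (μ + a)) ≡ 1ℚ → β′ * j′ ≡ β * (a + j) → u * q * r * α ≡ β′ →
      u * (- μ + κ) * (q * (M + a + κ)) * (r * i) * α ≡ β
    step u q r i α β β′ κ j μ M k′ j′ refl refl refl refl i≡ β≡ IH = begin
      u * (- μ + κ) * (q * (M + a + κ)) * (r * i) * α
        ≡⟨ collect u q r i α κ j a ⟩
      - (u * q * r * α) * j′ * (i * (M + a + κ))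
        ≡⟨ cong (λ v → - v * j′ * (i * (M + a + κ))) IH ⟩
      - β′ * j′ * (i * (M + a + κ))
        ≡⟨ reassoc β′ j′ (i * (M + a + κ)) ⟩
      - (β′ * j′) * (i * (M + a + κ))
        ≡⟨ cong (λ v → - v * (i * (M + a + κ))) β≡ ⟩
      - (β * (a + j)) * (i * (M + a + κ))
        ≡⟨ recombine i β κ j a ⟩
      β * (i * (k′ * k′ - (μ + a) * (μ + a)))
        ≡⟨ cong (β *_) i≡ ⟩
      β * 1ℚ
        ≡⟨ *-identityʳ β ⟩
      β ∎
      where
      collect : ∀ u q r i α κ j a →
        u * (- (κ + (j + 1ℚ)) + κ) * (q * (κ + (j + 1ℚ) + 1ℚ + a + κ)) * (r * i) * α
        ≡ - (u * q * r * α) * (j + 1ℚ) * (i * (κ + (j + 1ℚ) + 1ℚ + a + κ))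
      collect = solve-∀ ring
      reassoc : ∀ x y z → - x * y * z ≡ - (x * y) * z
      reassoc = solve-∀ ring
      recombine : ∀ i β κ j a → - (β * (a + j)) * (i * (κ + (j + 1ℚ) + 1ℚ + a + κ))
        ≡ β * (i * ((κ + 1ℚ) * (κ + 1ℚ) - (κ + (j + 1ℚ) + a) * (κ + (j + 1ℚ) + a)))
      recombine = solve-∀ ring

  whipple-sum : rising! a m * Σ< (suc m) (λ k → whippleTerm m k * ρ k) ≡ 1ℚ
  whipple-sum = begin
    rising! a m * Σ< (suc m) (λ k → whippleTerm m k * ρ k)
      ≡⟨ Σ<-*ˡ (suc m) (rising! a m) (λ k → whippleTerm m k * ρ k) ⟨
    Σ< (suc m) (λ k → rising! a m * (whippleTerm m k * ρ k))
      ≡⟨ Σ<-cong (suc m) (λ k k<1+m → trans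
           (collect (rising (- ι (+ m)) k) (rising (ι (+ suc m) + a) k) (rising! (1ℚ - a) k) (ρ k) (rising! a m))
           (cong (rising! (1ℚ - a) k *_) (cancelled-factor k (m ℕ.∸ k) (ℕ.m+[n∸m]≡n (ℕ.≤-pred k<1+m))))) ⟩
    Σ< (suc m) (λ k → rising! (1ℚ - a) k * rising! a (m ℕ.∸ k))
      ≡⟨ rising!-vandermonde a m ⟩
    1ℚ ∎
    where
    collect : ∀ u q w r α → α * (u * q * w * r) ≡ w * (u * q * r * α)
    collect = solve-∀ ring

  -- All terms beyond m contain the factor (m + a)² - y = 0. The truncation at n may thus be
  -- replaced by the one at m, for which the transformed sum is known by `whipple-sum`.
  terminating-whipple : ∀ {n} → m ℕ.< n → Σ< n t ≡ (- 1ℚ) ^ m * (a + ι (+ m))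
  terminating-whipple {n} m<n = begin
    Σ< n t
      ≡⟨ Σ<-vanishing (ℕ.≤⇒≤′ m<n) (λ k → t-vanishes) ⟩
    Σ< (suc m) t
      ≡⟨ truncated-whipple m ⟩
    (- 1ℚ) ^ m * (a * rising! (a + 1ℚ) m) * S
      ≡⟨ cong (λ u → (- 1ℚ) ^ m * u * S) a*rising! ⟩
    (- 1ℚ) ^ m * (rising! a m * (a + ι (+ m))) * S
      ≡⟨ regroup ((- 1ℚ) ^ m) (rising! a m) (a + ι (+ m)) S ⟩
    (- 1ℚ) ^ m * (a + ι (+ m)) * (rising! a m * S)
      ≡⟨ cong ((- 1ℚ) ^ m * (a + ι (+ m)) *_) whipple-sum ⟩
    (- 1ℚ) ^ m * (a + ι (+ m)) * 1ℚ
      ≡⟨ *-identityʳ ((- 1ℚ) ^ m * (a + ι (+ m))) ⟩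
    (- 1ℚ) ^ m * (a + ι (+ m)) ∎
    where
    S : ℚ
    S = Σ< (suc m) (λ k → whippleTerm m k * ρ k)
    regroup : ∀ σ α b s → σ * (α * b) * s ≡ σ * b * (α * s)
    regroup = solve-∀ ring
    reassoc : ∀ a u r M → a * (u * r) * M ≡ a * u * (r * M)
    reassoc = solve-∀ ring
    a*rising! : a * rising! (a + 1ℚ) m ≡ rising! a m * (a + ι (+ m))
    a*rising! = begin
      a * rising! (a + 1ℚ) m
        ≡⟨ *-identityʳ (a * rising! (a + 1ℚ) m) ⟨
      a * rising! (a + 1ℚ) m * 1ℚ
        ≡⟨ cong (a * rising! (a + 1ℚ) m *_) (recip-inverse m) ⟨
      a * rising! (a + 1ℚ) m * (recip m * ι (+ suc m))
        ≡⟨ reassoc a (rising! (a + 1ℚ) m) (recip m) (ι (+ suc m)) ⟨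
      a * (rising! (a + 1ℚ) m * recip m) * ι (+ suc m)
        ≡⟨ cong (_* ι (+ suc m)) (rising!-shift a m) ⟨
      rising! a (suc m) * ι (+ suc m)
        ≡⟨ rising!-suc a m ⟩
      rising! a m * (a + ι (+ m)) ∎

-- Pascal's rule and the rising factorial of 1/2

-- No division occurs here, so p-integrality passes between a and a + 1 in both directions.
rising!-pascal : ∀ a k → rising! (a + 1ℚ) (suc k) ≡ rising! (a + 1ℚ) k + rising! a (suc k)
rising!-pascal a k = begin
  B * ((a + 1ℚ + ι (+ k)) * recip k)
    ≡⟨ expand a B (ι (+ k)) (recip k) ⟩
  B * (recip k * (ι (+ k) + 1ℚ)) + a * (B * recip k)
    ≡⟨ cong₂ (λ u v → B * u + v) (trans (cong (recip k *_) (sym (ι-suc k))) (recip-inverse k))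
         (sym (rising!-shift a k)) ⟩
  B * 1ℚ + rising! a (suc k)
    ≡⟨ cong (_+ rising! a (suc k)) (*-identityʳ B) ⟩
  B + rising! a (suc k) ∎
  where
  B : ℚ
  B = rising! (a + 1ℚ) k
  expand : ∀ a B κ r → B * ((a + 1ℚ + κ) * r) ≡ B * (r * (κ + 1ℚ)) + a * (B * r)
  expand = solve-∀ ring

rising-1ℚ : ∀ k → rising 1ℚ k ≡ ι (+ (k ℕ.!))
rising-1ℚ zero    = refl
rising-1ℚ (suc k) = begin
  rising 1ℚ k * (1ℚ + ι (+ k))               ≡⟨ cong₂ _*_ (rising-1ℚ k) (sym (ι-+ (+ 1) (+ k))) ⟩
  ι (+ (k ℕ.!)) * ι (+ suc k)                ≡⟨ ι-* (+ (k ℕ.!)) (+ suc k) ⟨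
  ι (+ (k ℕ.!) ℤ.* + suc k)                  ≡⟨ cong ι (trans (ℤ.*-comm (+ (k ℕ.!)) (+ suc k)) (sym (ℤ.pos-* (suc k) (k ℕ.!)))) ⟩
  ι (+ (suc k ℕ.!))                          ∎

-- The even factors of (2k)! contribute 2^k k!, the odd ones 2^k (1/2)_k.
rising-½ : ∀ k → ι (+ (4 ℕ.^ k)) * (rising ½ k * rising 1ℚ k) ≡ ι (+ ((k ℕ.+ k) ℕ.!))
rising-½ zero    = refl
rising-½ (suc k) = begin
  ι (+ (4 ℕ.^ suc k)) * (rising ½ k * (½ + κ) * (rising 1ℚ k * (1ℚ + κ)))
    ≡⟨ cong (_* (rising ½ k * (½ + κ) * (rising 1ℚ k * (1ℚ + κ))))
         (sym (ι-pos-* 4 (4 ℕ.^ k))) ⟩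
  (1ℚ + 1ℚ) * (1ℚ + 1ℚ) * F * (rising ½ k * (½ + κ) * (rising 1ℚ k * (1ℚ + κ)))
    ≡⟨ regroup F (rising ½ k) (rising 1ℚ k) ½ κ ⟩
  (κ + κ + 1ℚ + 1ℚ) * ((κ + κ + (½ + ½)) * (F * (rising ½ k * rising 1ℚ k)))
    ≡⟨ cong₂ (λ u v → u * (v * (F * (rising ½ k * rising 1ℚ k))))
         (trans (cong (_+ 1ℚ) (sym 2k+1)) (sym (ι-suc (suc (k ℕ.+ k))))) (sym 2k+1) ⟩
  ι (+ suc (suc (k ℕ.+ k))) * (ι (+ suc (k ℕ.+ k)) * (F * (rising ½ k * rising 1ℚ k)))
    ≡⟨ cong (λ u → ι (+ suc (suc (k ℕ.+ k))) * (ι (+ suc (k ℕ.+ k)) * u)) (rising-½ k) ⟩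
  ι (+ suc (suc (k ℕ.+ k))) * (ι (+ suc (k ℕ.+ k)) * ι (+ ((k ℕ.+ k) ℕ.!)))
    ≡⟨ cong (ι (+ suc (suc (k ℕ.+ k))) *_) (ι-pos-* (suc (k ℕ.+ k)) ((k ℕ.+ k) ℕ.!)) ⟩
  ι (+ suc (suc (k ℕ.+ k))) * ι (+ (suc (k ℕ.+ k) ℕ.!))
    ≡⟨ ι-pos-* (suc (suc (k ℕ.+ k))) (suc (k ℕ.+ k) ℕ.!) ⟩
  ι (+ (suc (suc (k ℕ.+ k)) ℕ.!))
    ≡⟨ cong (λ n → ι (+ (suc n ℕ.!))) (ℕ.+-suc k k) ⟨
  ι (+ ((suc k ℕ.+ suc k) ℕ.!)) ∎
  where
  κ F : ℚ
  κ = ι (+ k)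
  F = ι (+ (4 ℕ.^ k))
  -- The 1 is kept as `½ + ½`, which evaluates to `1ℚ`, because ½ enters `regroup` as a variable h.
  2k+1 : ι (+ suc (k ℕ.+ k)) ≡ κ + κ + (½ + ½)
  2k+1 = trans (ι-suc (k ℕ.+ k)) (cong (_+ 1ℚ) (ι-+ (+ k) (+ k)))
  regroup : ∀ F u v h κ → (1ℚ + 1ℚ) * (1ℚ + 1ℚ) * F * (u * (h + κ) * (v * (1ℚ + κ)))
    ≡ (κ + κ + 1ℚ + 1ℚ) * ((κ + κ + (h + h)) * (F * (u * v)))
  regroup = solve-∀ ring

recip! : ∀ k → ℚ
recip! k = (1/ rising 1ℚ k) {{pos⇒nonZero (rising 1ℚ k) {{rising-pos 1ℚ k}}}}

recip!-inverse : ∀ k → recip! k * rising 1ℚ k ≡ 1ℚ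
recip!-inverse k = *-inverseˡ (rising 1ℚ k) {{pos⇒nonZero (rising 1ℚ k) {{rising-pos 1ℚ k}}}}

-- The localisation of ℤ at p inside ℚ

module Localisation {p : ℕ} (p-prime : Prime p) where

  p∤1 : p ∤ 1
  p∤1 p∣1 = ℕ.nonTrivial⇒≢1 {{prime⇒nonTrivial p-prime}} (∣1⇒≡1 p∣1)

  p∤* : ∀ {m n} → p ∤ m → p ∤ n → p ∤ m ℕ.* n
  p∤* {m} {n} p∤m p∤n p∣mn = [ p∤m , p∤n ]′ (euclidsLemma m n p-prime p∣mn)

  p∤^ : ∀ {m} k → p ∤ m → p ∤ m ℕ.^ k
  p∤^ zero    p∤m = p∤1
  p∤^ (suc k) p∤m = p∤* p∤m (p∤^ k p∤m)

  exactPower : ∀ n → n ≢ 0 → ∃ λ e → ExactPower p n e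
  exactPower = <-rec (λ n → n ≢ 0 → ∃ λ e → ExactPower p n e) split
    where
    split : ∀ n → (∀ {m} → m ℕ.< n → m ≢ 0 → ∃ λ e → ExactPower p m e) →
            n ≢ 0 → ∃ λ e → ExactPower p n e
    split n rec n≢0 with p ∣? n
    ... | no p∤n = 0 , 1∣ n , λ p¹∣n → p∤n (m*n∣⇒m∣ p 1 p¹∣n)
    ... | yes (divides m n≡mp) with rec m<n m≢0
      where
      m≢0 : m ≢ 0
      m≢0 refl = n≢0 n≡mp
      m<n : m ℕ.< n
      m<n = subst (m ℕ.<_) (sym n≡mp)
        (ℕ.m<m*n m p {{ℕ.≢-nonZero m≢0}} (ℕ.nonTrivial⇒n>1 p {{prime⇒nonTrivial p-prime}}))
    ...   | e , pᵉ∣m , pᵉ⁺¹∤m = suc e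
          , subst (p ℕ.^ suc e ∣_) (sym n≡pm) (*-monoʳ-∣ p pᵉ∣m)
          , λ d → pᵉ⁺¹∤m (*-cancelˡ-∣ p {{prime⇒nonZero p-prime}} (subst (p ℕ.^ suc (suc e) ∣_) n≡pm d))
      where
      n≡pm : n ≡ p ℕ.* m
      n≡pm = trans n≡mp (ℕ.*-comm m p)

  ^∣-cancel : ∀ {d} m {n} → p ∤ d → p ℕ.^ m ∣ d ℕ.* n → p ℕ.^ m ∣ n
  ^∣-cancel zero    {n} _ _ = 1∣ n
  ^∣-cancel {d} (suc m) {n} p∤d pᵐ⁺¹∣dn with euclidsLemma d n p-prime (m*n∣⇒m∣ p (p ℕ.^ m) pᵐ⁺¹∣dn)
  ... | inj₁ p∣d = contradiction p∣d p∤d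
  ... | inj₂ (divides q n≡qp) = subst (p ℕ.^ suc m ∣_) (sym n≡pq)
    (*-monoʳ-∣ p (^∣-cancel m p∤d (*-cancelˡ-∣ p {{prime⇒nonZero p-prime}}
      (subst (p ℕ.^ suc m ∣_) dn≡pdq pᵐ⁺¹∣dn))))
    where
    n≡pq : n ≡ p ℕ.* q
    n≡pq = trans n≡qp (ℕ.*-comm q p)
    dn≡pdq : d ℕ.* n ≡ p ℕ.* (d ℕ.* q)
    dn≡pdq = trans (cong (d ℕ.*_) n≡qp) (trans (sym (ℕ.*-assoc d q p)) (ℕ.*-comm (d ℕ.* q) p))

  infix 4 _∈p^_

  -- x ∈p^ m means x ∈ p^m ℤ₍ₚ₎.
  record _∈p^_ (x : ℚ) (m : ℕ) : Set where
    constructor fraction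
    field
      denominator numerator : ℤ
      p∤denominator : p ∤ ∣ denominator ∣
      scaled        : ι denominator * x ≡ ι (+ (p ℕ.^ m) ℤ.* numerator)

  p∤ℤ* : ∀ {c d} → p ∤ ∣ c ∣ → p ∤ ∣ d ∣ → p ∤ ∣ c ℤ.* d ∣
  p∤ℤ* {c} {d} p∤c p∤d = subst (p ∤_) (sym (ℤ.abs-* c d)) (p∤* p∤c p∤d)

  multiple∈ : ∀ m z → ι (+ (p ℕ.^ m) ℤ.* z) ∈p^ m
  multiple∈ m z = fraction (+ 1) z p∤1 (*-identityˡ (ι (+ (p ℕ.^ m) ℤ.* z)))

  ι∈ : ∀ z → ι z ∈p^ 0
  ι∈ z = subst (_∈p^ 0) (cong ι (ℤ.*-identityˡ z)) (multiple∈ 0 z)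

  0∈ : ∀ m → 0ℚ ∈p^ m
  0∈ m = subst (_∈p^ m) (cong ι (ℤ.*-zeroʳ (+ (p ℕ.^ m)))) (multiple∈ m (+ 0))

  ∈-divide : ∀ {m} d x → p ∤ ∣ d ∣ → ι d * x ∈p^ m → x ∈p^ m
  ∈-divide d x p∤d (fraction c z p∤c eq) =
    fraction (c ℤ.* d) z (p∤ℤ* {c} {d} p∤c p∤d)
      (trans (cong (_* x) (ι-* c d)) (trans (*-assoc (ι c) (ι d) x) eq))

  ∈-neg : ∀ {m} x → x ∈p^ m → - x ∈p^ m
  ∈-neg {m} x (fraction d z p∤d eq) = fraction d (ℤ.- z) p∤d (begin
    ι d * - x                          ≡⟨ neg-distribʳ-* (ι d) x ⟨
    - (ι d * x)                        ≡⟨ cong -_ eq ⟩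
    - ι (+ (p ℕ.^ m) ℤ.* z)            ≡⟨ ι-neg (+ (p ℕ.^ m) ℤ.* z) ⟨
    ι (ℤ.- (+ (p ℕ.^ m) ℤ.* z))        ≡⟨ cong ι (ℤ.neg-distribʳ-* (+ (p ℕ.^ m)) z) ⟩
    ι (+ (p ℕ.^ m) ℤ.* (ℤ.- z))        ∎)

  ∈-+ : ∀ {m} x y → x ∈p^ m → y ∈p^ m → x + y ∈p^ m
  ∈-+ {m} x y (fraction c u p∤c eqx) (fraction d v p∤d eqy) =
    fraction (c ℤ.* d) (d ℤ.* u ℤ.+ c ℤ.* v) (p∤ℤ* {c} {d} p∤c p∤d) (begin
      ι (c ℤ.* d) * (x + y)
        ≡⟨ cong (_* (x + y)) (ι-* c d) ⟩
      ι c * ι d * (x + y)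
        ≡⟨ distribute (ι c) (ι d) x y ⟩
      ι d * (ι c * x) + ι c * (ι d * y)
        ≡⟨ cong₂ (λ s t → ι d * s + ι c * t) eqx eqy ⟩
      ι d * ι (P ℤ.* u) + ι c * ι (P ℤ.* v)
        ≡⟨ cong₂ _+_ (ι-* d (P ℤ.* u)) (ι-* c (P ℤ.* v)) ⟨
      ι (d ℤ.* (P ℤ.* u)) + ι (c ℤ.* (P ℤ.* v))
        ≡⟨ ι-+ (d ℤ.* (P ℤ.* u)) (c ℤ.* (P ℤ.* v)) ⟨
      ι (d ℤ.* (P ℤ.* u) ℤ.+ c ℤ.* (P ℤ.* v))
        ≡⟨ cong ι (collect P c d u v) ⟩
      ι (P ℤ.* (d ℤ.* u ℤ.+ c ℤ.* v)) ∎)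
    where
    P : ℤ
    P = + (p ℕ.^ m)
    distribute : ∀ c d x y → c * d * (x + y) ≡ d * (c * x) + c * (d * y)
    distribute = solve-∀ ring
    collect : ∀ P c d u v → d ℤ.* (P ℤ.* u) ℤ.+ c ℤ.* (P ℤ.* v) ≡ P ℤ.* (d ℤ.* u ℤ.+ c ℤ.* v)
    collect = ℤ-solve-∀

  ^-+ : ∀ m n → + (p ℕ.^ (m ℕ.+ n)) ≡ + (p ℕ.^ m) ℤ.* + (p ℕ.^ n)
  ^-+ m n = trans (cong +_ (ℕ.^-distribˡ-+-* p m n)) (ℤ.pos-* (p ℕ.^ m) (p ℕ.^ n))

  ∈-* : ∀ {m n} x y → x ∈p^ m → y ∈p^ n → x * y ∈p^ (m ℕ.+ n)
  ∈-* {m} {n} x y (fraction c u p∤c eqx) (fraction d v p∤d eqy) =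
    fraction (c ℤ.* d) (u ℤ.* v) (p∤ℤ* {c} {d} p∤c p∤d) (begin
      ι (c ℤ.* d) * (x * y)
        ≡⟨ cong (_* (x * y)) (ι-* c d) ⟩
      ι c * ι d * (x * y)
        ≡⟨ interchange (ι c) (ι d) x y ⟩
      (ι c * x) * (ι d * y)
        ≡⟨ cong₂ _*_ eqx eqy ⟩
      ι (P ℤ.* u) * ι (Q ℤ.* v)
        ≡⟨ ι-* (P ℤ.* u) (Q ℤ.* v) ⟨
      ι ((P ℤ.* u) ℤ.* (Q ℤ.* v))
        ≡⟨ cong ι (interchangeℤ P Q u v) ⟩
      ι (P ℤ.* Q ℤ.* (u ℤ.* v))
        ≡⟨ cong (λ R → ι (R ℤ.* (u ℤ.* v))) (^-+ m n) ⟨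
      ι (+ (p ℕ.^ (m ℕ.+ n)) ℤ.* (u ℤ.* v)) ∎)
    where
    P Q : ℤ
    P = + (p ℕ.^ m)
    Q = + (p ℕ.^ n)
    interchange : ∀ c d x y → c * d * (x * y) ≡ (c * x) * (d * y)
    interchange = solve-∀ ring
    interchangeℤ : ∀ P Q u v → (P ℤ.* u) ℤ.* (Q ℤ.* v) ≡ P ℤ.* Q ℤ.* (u ℤ.* v)
    interchangeℤ = ℤ-solve-∀

  ∈-weaken : ∀ m n {x} → x ∈p^ (m ℕ.+ n) → x ∈p^ m
  ∈-weaken m n (fraction d z p∤d eq) = fraction d (+ (p ℕ.^ n) ℤ.* z) p∤d
    (trans eq (cong ι (trans (cong (ℤ._* z) (^-+ m n)) (ℤ.*-assoc (+ (p ℕ.^ m)) (+ (p ℕ.^ n)) z))))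

  ∈-Σ : ∀ {m} n {f : ℕ → ℚ} → (∀ k → k ℕ.< n → f k ∈p^ m) → Σ< n f ∈p^ m
  ∈-Σ {m} zero    _  = 0∈ m
  ∈-Σ (suc n) {f} f∈ =
    ∈-+ (Σ< n f) (f n) (∈-Σ n (λ k k<n → f∈ k (ℕ.m<n⇒m<1+n k<n))) (f∈ n (ℕ.n<1+n n))

  ∈⇒scaled-numerator : ∀ {m} x (x∈ : x ∈p^ m) → let open _∈p^_ x∈ in
    ∣ denominator ∣ ℕ.* ∣ ↥ x ∣ ≡ p ℕ.^ m ℕ.* ∣ numerator ∣ ℕ.* ↧ₙ x
  ∈⇒scaled-numerator {m} x@(mkℚ _ _ _) (fraction d z p∤d eq) with
    ℚᵘ.≃-trans (ℚᵘ.≃-sym (ℚᵘ.≃-trans (toℚᵘ-homo-* (ι d) x) (ℚᵘ.*-congʳ (toℚᵘ-ι d))))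
      (ℚᵘ.≃-trans (toℚᵘ-cong eq) (toℚᵘ-ι (+ (p ℕ.^ m) ℤ.* z)))
  ... | *≡* eqℤ = begin
    ∣ d ∣ ℕ.* ∣ ↥ x ∣                             ≡⟨ ℤ.abs-* d (↥ x) ⟨
    ∣ d ℤ.* ↥ x ∣                                 ≡⟨ cong ∣_∣ (ℤ.*-identityʳ (d ℤ.* ↥ x)) ⟨
    ∣ d ℤ.* ↥ x ℤ.* + 1 ∣                         ≡⟨ cong ∣_∣ eqℤ ⟩
    ∣ + (p ℕ.^ m) ℤ.* z ℤ.* (+ 1 ℤ.* ↧ x) ∣       ≡⟨ cong (λ u → ∣ + (p ℕ.^ m) ℤ.* z ℤ.* u ∣) (ℤ.*-identityˡ (↧ x)) ⟩
    ∣ + (p ℕ.^ m) ℤ.* z ℤ.* ↧ x ∣                 ≡⟨ ℤ.abs-* (+ (p ℕ.^ m) ℤ.* z) (↧ x) ⟩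
    ∣ + (p ℕ.^ m) ℤ.* z ∣ ℕ.* ↧ₙ x                ≡⟨ cong (ℕ._* ↧ₙ x) (ℤ.abs-* (+ (p ℕ.^ m)) z) ⟩
    p ℕ.^ m ℕ.* ∣ z ∣ ℕ.* ↧ₙ x                    ∎

  -- A witness d x = p^m z need not be reduced. Compared with the reduced form of x it shows that
  -- the reduced denominator divides d, hence is prime to p. The valuation of a nonzero x is then
  -- the exponent of p in the numerator, and p^m divides the numerator since p does not divide d.
  ∈⇒valuation : ∀ {m} x → x ∈p^ m → ∃ λ v → Valuation p x v × [ + m ] ≤⁺ v
  ∈⇒valuation {m} x x∈ with ∣ ↥ x ∣ ℕ.≟ 0
  ... | yes n≡0 = ⊤⁺ , infinite (↥p≡0⇒p≡0 x (ℤ.∣i∣≡0⇒i≡0 n≡0)) , ([ + m ] ≤⊤⁺)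
  ... | no n≢0 with exactPower ∣ ↥ x ∣ n≢0
  ...   | e , pᵉ∣n , pᵉ⁺¹∤n =
      [ e ⊖ 0 ] , finite {a = e} {b = 0} (pᵉ∣n , pᵉ⁺¹∤n) (1∣ ↧ₙ x , λ p¹∣d → p∤d (m*n∣⇒m∣ p 1 p¹∣d)) , [ ℤ.+≤+ m≤e ]
    where
    open _∈p^_ x∈
    p∤d : p ∤ ↧ₙ x
    p∤d p∣d = p∤denominator (∣-trans p∣d (coprime-divisor (coprime x)
      (divides (p ℕ.^ m ℕ.* ∣ numerator ∣)
        (trans (ℕ.*-comm ∣ ↥ x ∣ ∣ denominator ∣) (∈⇒scaled-numerator x x∈)))))
      where
      coprime : ∀ x → Coprime (↧ₙ x) ∣ ↥ x ∣
      coprime (mkℚ _ _ c) = Coprimality.sym (recompute c)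
    pᵐ∣n : p ℕ.^ m ∣ ∣ ↥ x ∣
    pᵐ∣n = ^∣-cancel m p∤denominator (subst (p ℕ.^ m ∣_) (sym (∈⇒scaled-numerator x x∈))
      (∣m⇒∣m*n (↧ₙ x) (m∣m*n ∣ numerator ∣)))
    m≤e : m ≤ e
    m≤e with m ℕ.≤? e
    ... | yes m≤e = m≤e
    ... | no m≰e = contradiction (∣-trans pᵉ⁺¹∣pᵐ pᵐ∣n) pᵉ⁺¹∤n
      where
      pᵉ⁺¹∣pᵐ : p ℕ.^ suc e ∣ p ℕ.^ m
      pᵉ⁺¹∣pᵐ = subst (p ℕ.^ suc e ∣_)
        (trans (sym (ℕ.^-distribˡ-+-* p (suc e) (m ℕ.∸ suc e))) (cong (p ℕ.^_) (ℕ.m+[n∸m]≡n (ℕ.≰⇒> m≰e))))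
        (m∣m*n (p ℕ.^ (m ℕ.∸ suc e)))

  -- The right form for the transformed terms at y = 0: there k!³ stands under three rising
  -- factorials, one k! for each.
  Integral : ℚ → Set
  Integral a = ∀ k → rising! a k ∈p^ 0

  integral-suc : ∀ a → Integral a → Integral (a + 1ℚ)
  integral-suc a a∈ zero    = ι∈ (+ 1)
  integral-suc a a∈ (suc k) = subst (_∈p^ 0) (sym (rising!-pascal a k))
    (∈-+ (rising! (a + 1ℚ) k) (rising! a (suc k)) (integral-suc a a∈ k) (a∈ (suc k)))

  integral-pred : ∀ a → Integral (a + 1ℚ) → Integral a
  integral-pred a a+1∈ zero    = ι∈ (+ 1)
  integral-pred a a+1∈ (suc k) = subst (_∈p^ 0)
    (trans (cong (_+ - rising! (a + 1ℚ) k) (rising!-pascal a k)) (cancel (rising! (a + 1ℚ) k) (rising! a (suc k))))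
    (∈-+ (rising! (a + 1ℚ) (suc k)) (- rising! (a + 1ℚ) k) (a+1∈ (suc k)) (∈-neg (rising! (a + 1ℚ) k) (a+1∈ k)))
    where
    cancel : ∀ u v → u + v - u ≡ v
    cancel = solve-∀ ring

  -- Descent by Pascal's rule from 0, where (0)_k / k! vanishes for k > 0.
  integral-neg : ∀ n → Integral (- ι (+ n))
  integral-neg zero    zero    = ι∈ (+ 1)
  integral-neg zero    (suc k) = subst (_∈p^ 0)
    (sym (trans (rising!-shift 0ℚ k) (*-zeroˡ (rising! (0ℚ + 1ℚ) k * recip k)))) (0∈ 0)
  integral-neg (suc n) = integral-pred (- ι (+ suc n))
    (subst Integral (sym (trans (cong (λ u → - u + 1ℚ) (ι-suc n)) (cancel (ι (+ n))))) (integral-neg n))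
    where
    cancel : ∀ u → - (u + 1ℚ) + 1ℚ ≡ - u
    cancel = solve-∀ ring

  integral-+ : ∀ a n → Integral a → Integral (ι (+ n) + a)
  integral-+ a zero    a∈ = subst Integral (sym (+-identityˡ a)) a∈
  integral-+ a (suc n) a∈ = subst Integral
    (trans (swap (ι (+ n)) a) (cong (_+ a) (sym (ι-suc n))))
    (integral-suc (ι (+ n) + a) (integral-+ a n a∈))
    where
    swap : ∀ u a → u + a + 1ℚ ≡ u + 1ℚ + a
    swap = solve-∀ ring

  -- 4^k (1/2)_k / k! is the central binomial coefficient, here the quotient z, and 4^k is prime to
  -- p.
  integral-½ : p ∤ 2 → Integral ½
  integral-½ p∤2 k with k![n∸k]!∣n! (ℕ.m≤m+n k k)
  ... | divides z [2k]!≡ = ∈-divide (+ (4 ℕ.^ k)) (rising! ½ k) (p∤^ k (p∤* {2} {2} p∤2 p∤2))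
      (subst (_∈p^ 0) (sym integer) (ι∈ (+ z)))
    where
    F R : ℚ
    F = ι (+ (4 ℕ.^ k))
    R = rising 1ℚ k
    regroup : ∀ F u R → R * R * (F * u) ≡ F * (u * R * R)
    regroup = solve-∀ ring
    swap : ∀ R z → z * (R * R) ≡ R * R * z
    swap = solve-∀ ring
    inverse-square : recip! k * recip! k * (R * R) ≡ 1ℚ
    inverse-square = trans (interchange (recip! k) R) (cong₂ _*_ (recip!-inverse k) (recip!-inverse k))
      where
      interchange : ∀ r R → r * r * (R * R) ≡ r * R * (r * R)
      interchange = solve-∀ ring
    integer : F * rising! ½ k ≡ ι (+ z)
    integer = *-cancelˡ-inverse (recip! k * recip! k) (R * R) (F * rising! ½ k) (ι (+ z)) inverse-square (begin
      R * R * (F * rising! ½ k)           ≡⟨ regroup F (rising! ½ k) R ⟩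
      F * (rising! ½ k * R * R)           ≡⟨ cong (λ u → F * (u * R)) (rising≡rising!*rising ½ k) ⟨
      F * (rising ½ k * R)                ≡⟨ rising-½ k ⟩
      ι (+ ((k ℕ.+ k) ℕ.!))               ≡⟨ cong (λ n → ι (+ n)) [2k]!≡ ⟩
      ι (+ (z ℕ.* (k ℕ.! ℕ.* (k ℕ.+ k ℕ.∸ k) ℕ.!)))
        ≡⟨ cong (λ n → ι (+ (z ℕ.* (k ℕ.! ℕ.* n ℕ.!)))) (ℕ.m+n∸n≡m k k) ⟩
      ι (+ (z ℕ.* (k ℕ.! ℕ.* k ℕ.!)))
        ≡⟨ sym (ι-pos-* z (k ℕ.! ℕ.* k ℕ.!)) ⟩
      ι (+ z) * ι (+ (k ℕ.! ℕ.* k ℕ.!))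
        ≡⟨ cong (ι (+ z) *_) (sym (ι-pos-* (k ℕ.!) (k ℕ.!))) ⟩
      ι (+ z) * (ι (+ (k ℕ.!)) * ι (+ (k ℕ.!)))
        ≡⟨ cong (λ u → ι (+ z) * (u * u)) (rising-1ℚ k) ⟨
      ι (+ z) * (R * R)                   ≡⟨ swap R (ι (+ z)) ⟩
      R * R * ι (+ z)                     ∎)

-- The series at y = 0 and its perturbation

module Central (a : ℚ) where

  recip²-inverse : ∀ k → recip k * recip k * (ι (+ suc k) * ι (+ suc k) - 0ℚ) ≡ 1ℚ
  recip²-inverse k = trans (regroup (recip k) (ι (+ suc k))) (cong₂ _*_ (recip-inverse k) (recip-inverse k))
    where
    regroup : ∀ r n → r * r * (n * n - 0ℚ) ≡ r * n * (r * n)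
    regroup = solve-∀ ring

  open TruncatedWhipple a 0ℚ (λ k → recip k * recip k) recip²-inverse public

  rising²*ρ : ∀ k → rising 1ℚ k * rising 1ℚ k * ρ k ≡ 1ℚ
  rising²*ρ zero    = refl
  rising²*ρ (suc k) = begin
    R * (1ℚ + ι (+ k)) * (R * (1ℚ + ι (+ k))) * (ρ k * (recip k * recip k))
      ≡⟨ regroup R (ι (+ k)) (ρ k) (recip k) ⟩
    R * R * ρ k * (recip k * (ι (+ k) + 1ℚ) * (recip k * (ι (+ k) + 1ℚ)))
      ≡⟨ cong (λ u → R * R * ρ k * (recip k * u * (recip k * u))) (ι-suc k) ⟨
    R * R * ρ k * (recip k * ι (+ suc k) * (recip k * ι (+ suc k)))
      ≡⟨ cong₂ (λ u v → u * (v * v)) (rising²*ρ k) (recip-inverse k) ⟩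
    1ℚ ∎
    where
    R : ℚ
    R = rising 1ℚ k
    regroup : ∀ R κ ρ r → R * (1ℚ + κ) * (R * (1ℚ + κ)) * (ρ * (r * r)) ≡
      R * R * ρ * (r * (κ + 1ℚ) * (r * (κ + 1ℚ)))
    regroup = solve-∀ ring

  e≡rising² : ∀ k → e k ≡ rising a k * rising a k
  e≡rising² zero    = refl
  e≡rising² (suc k) = trans (cong (_* ((ι (+ k) + a) * (ι (+ k) + a) - 0ℚ)) (e≡rising² k))
    (regroup (rising a k) (ι (+ k)) a)
    where
    regroup : ∀ u κ a → u * u * ((κ + a) * (κ + a) - 0ℚ) ≡ u * (a + κ) * (u * (a + κ))
    regroup = solve-∀ ring

  t≡ : ∀ k → t k ≡ (a + (ι (+ k) + ι (+ k))) * ((- 1ℚ) ^ k * rising! a k ^ 3)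
  t≡ k = begin
    b * (σ * u * e k * ρ k)
      ≡⟨ cong (λ v → b * (σ * u * v * ρ k))
           (trans (e≡rising² k) (cong₂ _*_ (rising≡rising!*rising a k) (rising≡rising!*rising a k))) ⟩
    b * (σ * u * (u * R * (u * R)) * ρ k)
      ≡⟨ regroup b σ u R (ρ k) ⟩
    b * (σ * (u * (u * (u * 1ℚ)))) * (R * R * ρ k)
      ≡⟨ cong (b * (σ * (u * (u * (u * 1ℚ)))) *_) (rising²*ρ k) ⟩
    b * (σ * u ^ 3) * 1ℚ
      ≡⟨ *-identityʳ (b * (σ * u ^ 3)) ⟩
    b * (σ * u ^ 3) ∎
    where
    b σ u R : ℚ
    b = a + (ι (+ k) + ι (+ k))
    σ = (- 1ℚ) ^ k
    u = rising! a k
    R = rising 1ℚ k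
    regroup : ∀ b σ u R r → b * (σ * u * (u * R * (u * R)) * r) ≡ b * (σ * (u * (u * (u * 1ℚ)))) * (R * R * r)
    regroup = solve-∀ ring

summand≡ : ∀ k → summand k ≡ (1ℚ + 1ℚ) * Central.t -½ k
summand≡ k = begin
  σ * (+ 4 / 1 * κ - 1ℚ) * (rising -½ k ^ 3 * inv)
    ≡⟨ cong (λ v → σ * (+ 4 / 1 * κ - 1ℚ) * (v ^ 3 * inv)) (rising≡rising!*rising -½ k) ⟩
  σ * (+ 4 / 1 * κ - 1ℚ) * ((u * R) ^ 3 * inv)
    ≡⟨ regroup σ κ -½ u R inv ⟩
  (1ℚ + 1ℚ) * ((-½ + (κ + κ)) * (σ * (u * (u * (u * 1ℚ))))) * (R * (R * (R * 1ℚ)) * inv)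
    ≡⟨ cong₂ (λ v w → (1ℚ + 1ℚ) * v * w) (sym (Central.t≡ -½ k))
         (*-inverseʳ (R ^ 3) {{rising-1^3-nonZero k}}) ⟩
  (1ℚ + 1ℚ) * Central.t -½ k * 1ℚ
    ≡⟨ *-identityʳ ((1ℚ + 1ℚ) * Central.t -½ k) ⟩
  (1ℚ + 1ℚ) * Central.t -½ k ∎
  where
  σ κ u R inv : ℚ
  σ = (- 1ℚ) ^ k
  κ = ι (+ k)
  u = rising! -½ k
  R = rising 1ℚ k
  inv = (1/ (R ^ 3)) {{rising-1^3-nonZero k}}
  -- For h = -½ the sum h + h evaluates to -1, so that 4k - 1 is read as 4k + (h + h) = 2 (h + 2k).
  regroup : ∀ σ κ h u R r →
    σ * ((1ℚ + 1ℚ + 1ℚ + 1ℚ) * κ + (h + h)) * (u * R * (u * R * (u * R * 1ℚ)) * r)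
    ≡ (1ℚ + 1ℚ) * ((h + (κ + κ)) * (σ * (u * (u * (u * 1ℚ))))) * (R * (R * (R * 1ℚ)) * r)
  regroup = solve-∀ ring

module Perturbation {p : ℕ} (p-prime : Prime p)
  (a y : ℚ) (i : ℕ → ℚ)
  (i-inverse : ∀ k → i k * (ι (+ suc k) * ι (+ suc k) - y) ≡ 1ℚ)
  (s n : ℕ) (y*i∈ : ∀ k → suc k ℕ.< n → Localisation._∈p^_ p-prime (y * i k) s)
  where

  open Localisation p-prime
  open TruncatedWhipple a y i i-inverse
  module C = Central a

  -- k!² `ρ k` is the product of j²/(j² - y) = 1 + y/(j² - y) over 1 ≤ j ≤ k. If the product so far
  -- is 1 + v, a further factor 1 + X changes v into v X + v + X.
  rising²*ρ-1∈ : ∀ k → k ℕ.< n → rising 1ℚ k * rising 1ℚ k * ρ k - 1ℚ ∈p^ s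
  rising²*ρ-1∈ zero    _     = 0∈ s
  rising²*ρ-1∈ (suc k) 1+k<n = subst (_∈p^ s) expand
    (∈-+ (v * X + v) X (∈-+ (v * X) v (∈-weaken s s (∈-* v X v∈ X∈)) v∈) X∈)
    where
    R v X : ℚ
    R = rising 1ℚ k
    v = R * R * ρ k - 1ℚ
    X = y * i k
    v∈ : v ∈p^ s
    v∈ = rising²*ρ-1∈ k (ℕ.<-trans (ℕ.n<1+n k) 1+k<n)
    X∈ : X ∈p^ s
    X∈ = y*i∈ k 1+k<n
    unit : 1ℚ + X ≡ (ι (+ k) + 1ℚ) * (ι (+ k) + 1ℚ) * i k
    unit = begin
      1ℚ + X                                                         ≡⟨ cong (_+ X) (i-inverse k) ⟨
      i k * (ι (+ suc k) * ι (+ suc k) - y) + y * i k                ≡⟨ cancel (i k) (ι (+ suc k)) y ⟩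
      ι (+ suc k) * ι (+ suc k) * i k                                ≡⟨ cong (λ u → u * u * i k) (ι-suc k) ⟩
      (ι (+ k) + 1ℚ) * (ι (+ k) + 1ℚ) * i k                          ∎
      where
      cancel : ∀ i n y → i * (n * n - y) + y * i ≡ n * n * i
      cancel = solve-∀ ring
    expand : v * X + v + X ≡ R * (1ℚ + ι (+ k)) * (R * (1ℚ + ι (+ k))) * (ρ k * i k) - 1ℚ
    expand = begin
      v * X + v + X
        ≡⟨ factor (R * R * ρ k) X ⟩
      R * R * ρ k * (1ℚ + X) - 1ℚ
        ≡⟨ cong (λ u → R * R * ρ k * u - 1ℚ) unit ⟩
      R * R * ρ k * ((ι (+ k) + 1ℚ) * (ι (+ k) + 1ℚ) * i k) - 1ℚ
        ≡⟨ regroup R (ρ k) (ι (+ k)) (i k) ⟩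
      R * (1ℚ + ι (+ k)) * (R * (1ℚ + ι (+ k))) * (ρ k * i k) - 1ℚ ∎
      where
      factor : ∀ u X → (u - 1ℚ) * X + (u - 1ℚ) + X ≡ u * (1ℚ + X) - 1ℚ
      factor = solve-∀ ring
      regroup : ∀ R ρ κ i → R * R * ρ * ((κ + 1ℚ) * (κ + 1ℚ) * i) - 1ℚ
        ≡ R * (1ℚ + κ) * (R * (1ℚ + κ)) * (ρ * i) - 1ℚ
      regroup = solve-∀ ring

  -- Both terms share a p-integral factor, the product of three quotients of the form (c)_k / k!.
  -- What remains is k!² times the respective `ρ k`, which is exactly 1 at y = 0.
  whippleTerm-difference∈ : ∀ m k → k ℕ.< n → Integral (ι (+ suc m) + a) → Integral (1ℚ - a) →
    C.whippleTerm m k * C.ρ k - whippleTerm m k * ρ k ∈p^ s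
  whippleTerm-difference∈ m k k<n m+1+a∈ 1-a∈ = subst (_∈p^ s) (sym difference)
    (∈-* (- (u * q * w)) (R * R * ρ k - 1ℚ)
      (∈-neg (u * q * w) (∈-* (u * q) w (∈-* u q (integral-neg m k) (m+1+a∈ k)) (1-a∈ k)))
      (rising²*ρ-1∈ k k<n))
    where
    R u q w : ℚ
    R = rising 1ℚ k
    u = rising! (- ι (+ m)) k
    q = rising! (ι (+ suc m) + a) k
    w = rising! (1ℚ - a) k
    factor : ∀ u q w R r₀ r → u * R * (q * R) * w * r₀ - u * R * (q * R) * w * r
      ≡ u * q * w * (R * R * r₀) - u * q * w * (R * R * r)
    factor = solve-∀ ring
    collect : ∀ z x → z * 1ℚ - z * x ≡ - z * (x - 1ℚ)
    collect = solve-∀ ring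
    difference : C.whippleTerm m k * C.ρ k - whippleTerm m k * ρ k ≡ - (u * q * w) * (R * R * ρ k - 1ℚ)
    difference = begin
      C.whippleTerm m k * C.ρ k - whippleTerm m k * ρ k
        ≡⟨ cong₂ (λ x z → x * z * w * C.ρ k - x * z * w * ρ k)
             (rising≡rising!*rising (- ι (+ m)) k) (rising≡rising!*rising (ι (+ suc m) + a) k) ⟩
      u * R * (q * R) * w * C.ρ k - u * R * (q * R) * w * ρ k
        ≡⟨ factor u q w R (C.ρ k) (ρ k) ⟩
      u * q * w * (R * R * C.ρ k) - u * q * w * (R * R * ρ k)
        ≡⟨ cong (λ x → u * q * w * x - u * q * w * (R * R * ρ k)) (C.rising²*ρ k) ⟩
      u * q * w * 1ℚ - u * q * w * (R * R * ρ k)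
        ≡⟨ collect (u * q * w) (R * R * ρ k) ⟩
      - (u * q * w) * (R * R * ρ k - 1ℚ) ∎

  -- Both sums are transformed with the same m, so the prefactor comes out of the difference and its
  -- exponent r adds to the exponent s of every term.
  Σt-difference∈ : ∀ {r} m → suc m ≤ n → whippleFactor m ∈p^ r → Integral (ι (+ suc m) + a) → Integral (1ℚ - a) →
    Σ< (suc m) C.t - Σ< (suc m) t ∈p^ (r ℕ.+ s)
  Σt-difference∈ {r} m 1+m≤n c∈ m+1+a∈ 1-a∈ = subst (_∈p^ (r ℕ.+ s)) (sym difference)
    (∈-* (whippleFactor m) (Σ< (suc m) d) c∈ (∈-Σ (suc m) {d}
      (λ k k<1+m → whippleTerm-difference∈ m k (ℕ.<-≤-trans k<1+m 1+m≤n) m+1+a∈ 1-a∈)))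
    where
    f₀ f d : ℕ → ℚ
    f₀ k = C.whippleTerm m k * C.ρ k
    f  k = whippleTerm m k * ρ k
    d  k = f₀ k - f k
    factor : ∀ c u v → c * u - c * v ≡ c * (u - v)
    factor = solve-∀ ring
    difference : Σ< (suc m) C.t - Σ< (suc m) t ≡ whippleFactor m * Σ< (suc m) d
    difference = begin
      Σ< (suc m) C.t - Σ< (suc m) t
        ≡⟨ cong₂ _-_ (C.truncated-whipple m) (truncated-whipple m) ⟩
      whippleFactor m * Σ< (suc m) f₀ - whippleFactor m * Σ< (suc m) f
        ≡⟨ factor (whippleFactor m) (Σ< (suc m) f₀) (Σ< (suc m) f) ⟩
      whippleFactor m * (Σ< (suc m) f₀ - Σ< (suc m) f)
        ≡⟨ cong (whippleFactor m *_) (Σ<-- (suc m) f₀ f) ⟨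
      whippleFactor m * Σ< (suc m) d ∎

-- Odd prime powers

even⊎odd : ∀ n → (∃ λ q → n ≡ q ℕ.+ q) ⊎ (∃ λ q → n ≡ suc (q ℕ.+ q))
even⊎odd zero = inj₁ (0 , refl)
even⊎odd (suc n) with even⊎odd n
... | inj₁ (q , refl) = inj₂ (q , refl)
... | inj₂ (q , refl) = inj₁ (suc q , cong suc (sym (ℕ.+-suc q q)))

odd : ∀ {n} → 2 ∤ n → ∃ λ q → n ≡ suc (q ℕ.+ q)
odd {n} 2∤n with even⊎odd n
... | inj₂ n-odd = n-odd
... | inj₁ (q , refl) = contradiction
  (divides q (trans (cong (q ℕ.+_) (sym (ℕ.+-identityʳ q))) (ℕ.*-comm 2 q))) 2∤n

-1^[n+n] : ∀ n → (- 1ℚ) ^ (n ℕ.+ n) ≡ 1ℚ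
-1^[n+n] zero    = refl
-1^[n+n] (suc n) = trans (cong (λ k → - 1ℚ * (- 1ℚ) ^ k) (ℕ.+-suc n n))
  (cong (λ x → - 1ℚ * (- 1ℚ * x)) (-1^[n+n] n))

-- (2q+1)(2n+1) = 2 (q + n + 2qn) + 1, and 2qn does not affect the sign. The exponents (p^r - 1)/2
-- and r (p - 1)/2 differ in general but have the same parity, so only the signs are compared.
odd-^ : ∀ q r → ∃ λ n → suc (q ℕ.+ q) ℕ.^ r ≡ suc (n ℕ.+ n) × (- 1ℚ) ^ n ≡ (- 1ℚ) ^ (q ℕ.* r)
odd-^ q zero    = 0 , refl , cong ((- 1ℚ) ^_) (sym (ℕ.*-zeroʳ q))
odd-^ q (suc r) with odd-^ q r
... | n , p^r≡ , sign≡ = n′ , power , sign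
  where
  n′ : ℕ
  n′ = q ℕ.+ n ℕ.+ (q ℕ.* n ℕ.+ q ℕ.* n)
  expand : ∀ q n → (1 ℕ.+ (q ℕ.+ q)) ℕ.* (1 ℕ.+ (n ℕ.+ n)) ≡
    1 ℕ.+ (q ℕ.+ n ℕ.+ (q ℕ.* n ℕ.+ q ℕ.* n) ℕ.+ (q ℕ.+ n ℕ.+ (q ℕ.* n ℕ.+ q ℕ.* n)))
  expand = ℕ-solve-∀
  power : suc (q ℕ.+ q) ℕ.^ suc r ≡ suc (n′ ℕ.+ n′)
  power = trans (cong (suc (q ℕ.+ q) ℕ.*_) p^r≡) (expand q n)
  sign : (- 1ℚ) ^ n′ ≡ (- 1ℚ) ^ (q ℕ.* suc r)
  sign = begin
    (- 1ℚ) ^ n′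
      ≡⟨ ^-homo-* (- 1ℚ) (q ℕ.+ n) (q ℕ.* n ℕ.+ q ℕ.* n) ⟩
    (- 1ℚ) ^ (q ℕ.+ n) * (- 1ℚ) ^ (q ℕ.* n ℕ.+ q ℕ.* n)
      ≡⟨ cong ((- 1ℚ) ^ (q ℕ.+ n) *_) (-1^[n+n] (q ℕ.* n)) ⟩
    (- 1ℚ) ^ (q ℕ.+ n) * 1ℚ
      ≡⟨ *-identityʳ ((- 1ℚ) ^ (q ℕ.+ n)) ⟩
    (- 1ℚ) ^ (q ℕ.+ n)
      ≡⟨ ^-homo-* (- 1ℚ) q n ⟩
    (- 1ℚ) ^ q * (- 1ℚ) ^ n
      ≡⟨ cong ((- 1ℚ) ^ q *_) sign≡ ⟩
    (- 1ℚ) ^ q * (- 1ℚ) ^ (q ℕ.* r)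
      ≡⟨ ^-homo-* (- 1ℚ) q (q ℕ.* r) ⟨
    (- 1ℚ) ^ (q ℕ.+ q ℕ.* r)
      ≡⟨ cong ((- 1ℚ) ^_) (ℕ.*-suc q r) ⟨
    (- 1ℚ) ^ (q ℕ.* suc r) ∎

-- Write 1 + k = p^s j with p ∤ j and N = p^(s+1) M; then y i = p² M² / (4 j² - p² M²).
perturbation∈ : ∀ {p} (p-prime : Prime p) → p ∤ 2 → ∀ r N → p ℕ.^ suc r ≡ N →
  ∀ y → ι (+ 4) * y ≡ ι (+ (N ℕ.* N)) →
  ∀ k i → i * (ι (+ suc k) * ι (+ suc k) - y) ≡ 1ℚ → suc k ℕ.< N →
  Localisation._∈p^_ p-prime (y * i) 2
perturbation∈ {p} p-prime p∤2 r N p^[1+r]≡ y 4y≡N² k i i-inverse 1+k<N with Localisation.exactPower p-prime (suc k) (λ ())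
... | s , divides j 1+k≡j*pˢ , pˢ⁺¹∤1+k = Localisation.fraction d (+ (M ℕ.* M)) p∤d scaled
  where
  open Localisation p-prime
  P : ℕ
  P = p ℕ.^ s
  -- Otherwise N = p^(1+r) ≤ p^s ≤ 1 + k.
  s<1+r : s ℕ.< suc r
  s<1+r with s ℕ.<? suc r
  ... | yes s<1+r = s<1+r
  ... | no s≮1+r = contradiction 1+k<N (ℕ.≤⇒≯ (ℕ.≤-trans (ℕ.≤-reflexive (sym p^[1+r]≡))
    (ℕ.≤-trans (ℕ.^-monoʳ-≤ p {{prime⇒nonZero p-prime}} (ℕ.≮⇒≥ s≮1+r)) (∣⇒≤ (divides j 1+k≡j*pˢ)))))
  M : ℕ
  M = p ℕ.^ (r ℕ.∸ s)
  N≡ : N ≡ P ℕ.* (p ℕ.* M)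
  N≡ = begin
    N                              ≡⟨ p^[1+r]≡ ⟨
    p ℕ.^ suc r                    ≡⟨ cong (p ℕ.^_) (ℕ.m+[n∸m]≡n s<1+r) ⟨
    p ℕ.^ (suc s ℕ.+ (r ℕ.∸ s))    ≡⟨ ℕ.^-distribˡ-+-* p (suc s) (r ℕ.∸ s) ⟩
    p ℕ.* P ℕ.* M                  ≡⟨ regroup p P M ⟩
    P ℕ.* (p ℕ.* M)                ∎
    where
    regroup : ∀ p P M → p ℕ.* P ℕ.* M ≡ P ℕ.* (p ℕ.* M)
    regroup = ℕ-solve-∀
  d : ℤ
  d = + (4 ℕ.* (j ℕ.* j)) ℤ.- + (p ℕ.* (M ℕ.* (p ℕ.* M)))
  p∤j : p ∤ j
  p∤j (divides q j≡qp) = pˢ⁺¹∤1+k (divides q (trans 1+k≡j*pˢ (trans (cong (ℕ._* P) j≡qp) (ℕ.*-assoc q p P))))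
  p∤d : p ∤ ∣ d ∣
  p∤d p∣d = p∤* {4} {j ℕ.* j} (p∤* {2} {2} p∤2 p∤2) (p∤* p∤j p∤j)
    (∣⇒∣ᵤ (subst (+ p ∣ℤ_) (restore (+ (4 ℕ.* (j ℕ.* j))) (+ (p ℕ.* (M ℕ.* (p ℕ.* M)))))
      (∣m∣n⇒∣m+nℤ {i = + p} (∣ᵤ⇒∣ {+ p} {d} p∣d)
        (∣ᵤ⇒∣ {+ p} {+ (p ℕ.* (M ℕ.* (p ℕ.* M)))} (m∣m*n (M ℕ.* (p ℕ.* M)))))))
    where
    restore : ∀ u v → u ℤ.- v ℤ.+ v ≡ u
    restore = ℤ-solve-∀
  -- Multiplication by p^(2s) turns d into 4 (1+k)² - N², which is 4 times the reciprocal of i.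
  scaled : ι d * (y * i) ≡ ι (+ (p ℕ.^ 2) ℤ.* + (M ℕ.* M))
  scaled = *-cancelˡ-inverse (inverse (ι (+ (P ℕ.* P))) PP≢0) (ι (+ (P ℕ.* P))) (ι d * (y * i)) (ι (+ (p ℕ.^ 2) ℤ.* + (M ℕ.* M)))
    (inverse-inverseˡ (ι (+ (P ℕ.* P))) PP≢0) (begin
      ι PP * (ι d * (y * i))
        ≡⟨ *-assoc (ι PP) (ι d) (y * i) ⟨
      ι PP * ι d * (y * i)
        ≡⟨ cong (_* (y * i)) (trans (sym (ι-* PP d)) (cong ι PPd)) ⟩
      ι (+ (4 ℕ.* (suc k ℕ.* suc k)) ℤ.- + (N ℕ.* N)) * (y * i)
        ≡⟨ cong (_* (y * i)) (trans (ι-+ (+ (4 ℕ.* (suc k ℕ.* suc k))) (ℤ.- + (N ℕ.* N)))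
             (cong₂ _+_ (trans (sym (ι-pos-* 4 (suc k ℕ.* suc k))) (cong (ι (+ 4) *_) (sym (ι-pos-* (suc k) (suc k)))))
                        (trans (ι-neg (+ (N ℕ.* N))) (cong -_ (sym 4y≡N²))))) ⟩
      (ι (+ 4) * (K * K) - ι (+ 4) * y) * (y * i)
        ≡⟨ regroup (ι (+ 4)) K y i ⟩
      ι (+ 4) * y * (i * (K * K - y))
        ≡⟨ cong (ι (+ 4) * y *_) i-inverse ⟩
      ι (+ 4) * y * 1ℚ
        ≡⟨ *-identityʳ (ι (+ 4) * y) ⟩
      ι (+ 4) * y
        ≡⟨ 4y≡N² ⟩
      ι (+ (N ℕ.* N))
        ≡⟨ cong (λ m → ι (+ m)) NN ⟩
      ι (+ (P ℕ.* P ℕ.* (p ℕ.^ 2 ℕ.* (M ℕ.* M))))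
        ≡⟨ trans (cong ι (ℤ.pos-* (P ℕ.* P) (p ℕ.^ 2 ℕ.* (M ℕ.* M)))) (ι-* PP (+ (p ℕ.^ 2 ℕ.* (M ℕ.* M)))) ⟩
      ι PP * ι (+ (p ℕ.^ 2 ℕ.* (M ℕ.* M)))
        ≡⟨ cong (λ m → ι PP * ι m) (ℤ.pos-* (p ℕ.^ 2) (M ℕ.* M)) ⟩
      ι PP * ι (+ (p ℕ.^ 2) ℤ.* + (M ℕ.* M)) ∎)
    where
    PP : ℤ
    PP = + (P ℕ.* P)
    K : ℚ
    K = ι (+ suc k)
    PP≢0 : ι (+ (P ℕ.* P)) ≢ 0ℚ
    PP≢0 eq = ℕ.≢-nonZero⁻¹ (P ℕ.* P) {{ℕ.m*n≢0 P P {{P≢0}} {{P≢0}}}} (ℤ.+-injective (ι-injective {+ (P ℕ.* P)} {+ 0} eq))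
      where
      P≢0 = ℕ.m^n≢0 p s {{prime⇒nonZero p-prime}}
    regroup : ∀ c K y i → (c * (K * K) - c * y) * (y * i) ≡ c * y * (i * (K * K - y))
    regroup = solve-∀ ring
    NN : N ℕ.* N ≡ P ℕ.* P ℕ.* (p ℕ.^ 2 ℕ.* (M ℕ.* M))
    NN = trans (cong₂ ℕ._*_ N≡ N≡) (rearrange P p M)
      where
      rearrange : ∀ P p M → P ℕ.* (p ℕ.* M) ℕ.* (P ℕ.* (p ℕ.* M)) ≡ P ℕ.* P ℕ.* (p ℕ.* (p ℕ.* 1) ℕ.* (M ℕ.* M))
      rearrange = ℕ-solve-∀
    PPd : PP ℤ.* d ≡ + (4 ℕ.* (suc k ℕ.* suc k)) ℤ.- + (N ℕ.* N)
    PPd = begin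
      PP ℤ.* (+ (4 ℕ.* (j ℕ.* j)) ℤ.- + (p ℕ.* (M ℕ.* (p ℕ.* M))))
        ≡⟨ distribute PP (+ (4 ℕ.* (j ℕ.* j))) (+ (p ℕ.* (M ℕ.* (p ℕ.* M)))) ⟩
      PP ℤ.* + (4 ℕ.* (j ℕ.* j)) ℤ.- PP ℤ.* + (p ℕ.* (M ℕ.* (p ℕ.* M)))
        ≡⟨ cong₂ ℤ._-_ (sym (ℤ.pos-* (P ℕ.* P) (4 ℕ.* (j ℕ.* j)))) (sym (ℤ.pos-* (P ℕ.* P) (p ℕ.* (M ℕ.* (p ℕ.* M))))) ⟩
      + (P ℕ.* P ℕ.* (4 ℕ.* (j ℕ.* j))) ℤ.- + (P ℕ.* P ℕ.* (p ℕ.* (M ℕ.* (p ℕ.* M))))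
        ≡⟨ cong₂ (λ u v → + u ℤ.- + v)
             (trans (first P j) (cong (λ u → 4 ℕ.* (u ℕ.* u)) (sym 1+k≡j*pˢ)))
             (trans (second P p M) (cong (λ u → u ℕ.* u) (sym N≡))) ⟩
      + (4 ℕ.* (suc k ℕ.* suc k)) ℤ.- + (N ℕ.* N) ∎
      where
      distribute : ∀ u v w → u ℤ.* (v ℤ.- w) ≡ u ℤ.* v ℤ.- u ℤ.* w
      distribute = ℤ-solve-∀
      first : ∀ P j → P ℕ.* P ℕ.* (4 ℕ.* (j ℕ.* j)) ≡ 4 ℕ.* (j ℕ.* P ℕ.* (j ℕ.* P))
      first = ℕ-solve-∀
      second : ∀ P p M → P ℕ.* P ℕ.* (p ℕ.* (M ℕ.* (p ℕ.* M))) ≡ P ℕ.* (p ℕ.* M) ℕ.* (P ℕ.* (p ℕ.* M))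
      second = ℕ-solve-∀

-- Writing p^(1+r) as 2 (n+1) + 1 makes (N-1)/2 = n + 1 and (N+1)/2 = n + 2 available without
-- division and ensures N ≥ 3.
module OddPrimePower {p : ℕ} (p-prime : Prime p) (p∤2 : p ∤ 2)
  (r n : ℕ) (p^[1+r]≡ : p ℕ.^ suc r ≡ suc (suc n ℕ.+ suc n))
  where

  open Localisation p-prime

  N : ℕ
  N = suc (suc n ℕ.+ suc n)

  p∣N : p ∣ N
  p∣N = subst (p ∣_) p^[1+r]≡ (m∣m*n (p ℕ.^ r))

  -- x is N/2, written as m + a with m = (N+1)/2 and a = -1/2. In this form y is literally the (m +
  -- a)² of `TerminatingWhipple`, and `T.t` coincides by definition with the perturbed terms of
  -- `Perturbation`.
  x y : ℚ
  x = ι (+ suc (suc n)) + -½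
  y = x * x

  2x≡N : (1ℚ + 1ℚ) * x ≡ ι (+ N)
  2x≡N = begin
    (1ℚ + 1ℚ) * (ι (+ suc (suc n)) + -½)         ≡⟨ cong (λ u → (1ℚ + 1ℚ) * (u + -½)) (ι-suc (suc n)) ⟩
    (1ℚ + 1ℚ) * (ι (+ suc n) + 1ℚ + -½)          ≡⟨ expand (ι (+ suc n)) -½ ⟩
    ι (+ suc n) + ι (+ suc n) + (1ℚ + 1ℚ + (-½ + -½)) ≡⟨ cong (_+ 1ℚ) (ι-+ (+ suc n) (+ suc n)) ⟨
    ι (+ (suc n ℕ.+ suc n)) + 1ℚ                 ≡⟨ ι-suc (suc n ℕ.+ suc n) ⟨
    ι (+ N)                                      ∎
    where
    expand : ∀ ν h → (1ℚ + 1ℚ) * (ν + 1ℚ + h) ≡ ν + ν + (1ℚ + 1ℚ + (h + h))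
    expand = solve-∀ ring

  4y≡N² : ι (+ 4) * y ≡ ι (+ (N ℕ.* N))
  4y≡N² = begin
    (1ℚ + 1ℚ) * (1ℚ + 1ℚ) * (x * x)         ≡⟨ square x ⟩
    (1ℚ + 1ℚ) * x * ((1ℚ + 1ℚ) * x)         ≡⟨ cong₂ _*_ 2x≡N 2x≡N ⟩
    ι (+ N) * ι (+ N)                       ≡⟨ ι-pos-* N N ⟩
    ι (+ (N ℕ.* N))                         ∎
    where
    square : ∀ x → (1ℚ + 1ℚ) * (1ℚ + 1ℚ) * (x * x) ≡ (1ℚ + 1ℚ) * x * ((1ℚ + 1ℚ) * x)
    square = solve-∀ ring

  -- 4y = N² is odd, while 4j² is even.
  j²≢y : ∀ j → ι (+ j) * ι (+ j) - y ≢ 0ℚ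
  j²≢y j j²-y≡0 = Localisation.p∤* prime[2] {N} {N} 2∤N 2∤N
    (divides (2 ℕ.* (j ℕ.* j)) (ℤ.+-injective (ι-injective (begin
      ι (+ (N ℕ.* N))                                ≡⟨ 4y≡N² ⟨
      ι (+ 4) * y                                    ≡⟨ restore (ι (+ 4)) y (ι (+ j) * ι (+ j)) ⟩
      ι (+ 4) * (j² - (j² - y))                      ≡⟨ cong (λ u → ι (+ 4) * (j² - u)) j²-y≡0 ⟩
      ι (+ 4) * (j² - 0ℚ)                            ≡⟨ cong (ι (+ 4) *_) (+-identityʳ j²) ⟩
      ι (+ 4) * (ι (+ j) * ι (+ j))                  ≡⟨ cong (ι (+ 4) *_) (ι-pos-* j j) ⟩
      ι (+ 4) * ι (+ (j ℕ.* j))                      ≡⟨ ι-pos-* 4 (j ℕ.* j) ⟩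
      ι (+ (4 ℕ.* (j ℕ.* j)))                        ≡⟨ cong (λ k → ι (+ k)) (regroup (j ℕ.* j)) ⟩
      ι (+ (2 ℕ.* (j ℕ.* j) ℕ.* 2))                  ∎))))
    where
    j² : ℚ
    j² = ι (+ j) * ι (+ j)
    restore : ∀ c y J → c * y ≡ c * (J - (J - y))
    restore = solve-∀ ring
    regroup : ∀ k → 4 ℕ.* k ≡ 2 ℕ.* k ℕ.* 2
    regroup = ℕ-solve-∀
    2∤N : 2 ∤ N
    2∤N 2∣N = Localisation.p∤1 prime[2] (∣m+n∣m⇒∣n (subst (2 ∣_) (ℕ.+-comm 1 (suc n ℕ.+ suc n)) 2∣N)
      (divides (suc n) (double (suc n))))
      where
      double : ∀ k → k ℕ.+ k ≡ k ℕ.* 2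
      double = ℕ-solve-∀

  i : ℕ → ℚ
  i k = inverse (ι (+ suc k) * ι (+ suc k) - y) (j²≢y (suc k))

  i-inverse : ∀ k → i k * (ι (+ suc k) * ι (+ suc k) - y) ≡ 1ℚ
  i-inverse k = inverse-inverseˡ (ι (+ suc k) * ι (+ suc k) - y) (j²≢y (suc k))

  y*i∈ : ∀ k → suc k ℕ.< N → y * i k ∈p^ 2
  y*i∈ k = perturbation∈ p-prime p∤2 r N p^[1+r]≡ y 4y≡N² k (i k) (i-inverse k)

  open Perturbation p-prime -½ y i i-inverse 2 N y*i∈
  module T = TerminatingWhipple -½ (suc (suc n)) i i-inverse

  ½∈ : Integral ½
  ½∈ = integral-½ p∤2

  -- (1/2)_{N-1} / (N-1)! = N / (N - 1/2) * (1/2)_N / N! carries the factor N = p^(1+r).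
  rising!∈ : rising! ½ (suc n ℕ.+ suc n) ∈p^ suc r
  rising!∈ = ∈-divide (+ suc (m ℕ.+ m)) B p∤2m+1
    (subst (_∈p^ suc r) (sym scaled)
        (∈-* (1ℚ + 1ℚ) (rising! ½ N * ι (+ N)) (ι∈ (+ 2))
          (∈-* (rising! ½ N) (ι (+ N)) (½∈ N)
            (subst (_∈p^ suc r) (cong ι (trans (ℤ.*-identityʳ (+ (p ℕ.^ suc r))) (cong +_ p^[1+r]≡)))
              (multiple∈ (suc r) (+ 1))))))
    where
    m : ℕ
    m = suc n ℕ.+ suc n
    B : ℚ
    B = rising! ½ m
    -- Since m = N - 1, the successor of 2m + 1 is 2N, a multiple of p.
    p∤2m+1 : p ∤ suc (m ℕ.+ m)
    p∤2m+1 p∣2m+1 = p∤1 (∣m+n∣m⇒∣n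
      (subst (p ∣_) (regroup m) (∣m∣n⇒∣m+n p∣N p∣N)) p∣2m+1)
      where
      regroup : ∀ m → suc m ℕ.+ suc m ≡ suc (m ℕ.+ m) ℕ.+ 1
      regroup m = trans (cong suc (ℕ.+-suc m m)) (ℕ.+-comm 1 (suc (m ℕ.+ m)))
    scaled : ι (+ suc (m ℕ.+ m)) * B ≡ (1ℚ + 1ℚ) * (rising! ½ N * ι (+ N))
    scaled = begin
      ι (+ suc (m ℕ.+ m)) * B                  ≡⟨ cong (_* B) (trans (ι-suc (m ℕ.+ m)) (cong (_+ 1ℚ) (ι-+ (+ m) (+ m)))) ⟩
      (ι (+ m) + ι (+ m) + (½ + ½)) * B        ≡⟨ regroup (ι (+ m)) ½ B ⟩
      (1ℚ + 1ℚ) * (B * (½ + ι (+ m)))          ≡⟨ cong ((1ℚ + 1ℚ) *_) (rising!-suc ½ m) ⟨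
      (1ℚ + 1ℚ) * (rising! ½ N * ι (+ N))      ∎
      where
      regroup : ∀ μ h B → (μ + μ + (h + h)) * B ≡ (1ℚ + 1ℚ) * (B * (h + μ))
      regroup = solve-∀ ring

  whippleFactor∈ : T.whippleFactor (suc n ℕ.+ suc n) ∈p^ suc r
  whippleFactor∈ = ∈-divide (+ 2) (T.whippleFactor m) p∤2 (subst (_∈p^ suc r) (sym twice)
    (∈-neg (rising! ½ m) rising!∈))
    where
    m : ℕ
    m = suc n ℕ.+ suc n
    twice : (1ℚ + 1ℚ) * ((- 1ℚ) ^ m * (-½ * rising! ½ m)) ≡ - rising! ½ m
    twice = begin
      (1ℚ + 1ℚ) * ((- 1ℚ) ^ m * (-½ * rising! ½ m))
        ≡⟨ cong (λ u → (1ℚ + 1ℚ) * (u * (-½ * rising! ½ m))) (-1^[n+n] (suc n)) ⟩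
      (1ℚ + 1ℚ) * (1ℚ * (-½ * rising! ½ m))
        ≡⟨ collect -½ (rising! ½ m) ⟩
      (-½ + -½) * rising! ½ m
        ≡⟨ negate (rising! ½ m) ⟩
      - rising! ½ m ∎
      where
      collect : ∀ h B → (1ℚ + 1ℚ) * (1ℚ * (h * B)) ≡ (h + h) * B
      collect = solve-∀ ring
      negate : ∀ B → - 1ℚ * B ≡ - B
      negate = solve-∀ ring

  evaluation : (1ℚ + 1ℚ) * Σ< N T.t ≡ - ((- 1ℚ) ^ suc n * ι (+ N))
  evaluation = begin
    (1ℚ + 1ℚ) * Σ< N T.t
      -- The bound is (N+1)/2 < N, which holds because N ≥ 3.
      ≡⟨ cong ((1ℚ + 1ℚ) *_) (T.terminating-whipple (ℕ.s≤s (ℕ.s≤s (ℕ.m≤n+m (suc n) n)))) ⟩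
    (1ℚ + 1ℚ) * (- 1ℚ * (- 1ℚ) ^ suc n * (-½ + ι (+ suc (suc n))))
      ≡⟨ regroup ((- 1ℚ) ^ suc n) -½ (ι (+ suc (suc n))) ⟩
    - ((- 1ℚ) ^ suc n * ((1ℚ + 1ℚ) * x))
      ≡⟨ cong (λ u → - ((- 1ℚ) ^ suc n * u)) 2x≡N ⟩
    - ((- 1ℚ) ^ suc n * ι (+ N)) ∎
    where
    regroup : ∀ σ h ν → (1ℚ + 1ℚ) * (- 1ℚ * σ * (h + ν)) ≡ - (σ * ((1ℚ + 1ℚ) * (ν + h)))
    regroup = solve-∀ ring

  Σsummand∈ : Σ< N summand - - ((- 1ℚ) ^ suc n * ι (+ N)) ∈p^ (suc r ℕ.+ 2)
  Σsummand∈ = subst (_∈p^ (suc r ℕ.+ 2)) twice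
    (∈-* (1ℚ + 1ℚ) (Σ< N C.t - Σ< N T.t) (ι∈ (+ 2))
      (Σt-difference∈ (suc n ℕ.+ suc n) ℕ.≤-refl whippleFactor∈
        -- For m = N - 1 the parameter m + 1 + a is N - 1/2, reached from -1/2, and 1 - a is 3/2;
        -- `-½ + 1ℚ` and `½ + 1ℚ` are computed by evaluation.
        (integral-+ -½ N (integral-pred -½ ½∈)) (integral-suc ½ ½∈)))
    where
    distribute : ∀ u v → (1ℚ + 1ℚ) * (u - v) ≡ (1ℚ + 1ℚ) * u - (1ℚ + 1ℚ) * v
    distribute = solve-∀ ring
    twice : (1ℚ + 1ℚ) * (Σ< N C.t - Σ< N T.t) ≡ Σ< N summand - - ((- 1ℚ) ^ suc n * ι (+ N))
    twice = begin
      (1ℚ + 1ℚ) * (Σ< N C.t - Σ< N T.t)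
        ≡⟨ distribute (Σ< N C.t) (Σ< N T.t) ⟩
      (1ℚ + 1ℚ) * Σ< N C.t - (1ℚ + 1ℚ) * Σ< N T.t
        ≡⟨ cong₂ _-_ (trans (sym (Σ<-*ˡ N (1ℚ + 1ℚ) C.t)) (Σ<-cong N (λ k _ → sym (summand≡ k)))) evaluation ⟩
      Σ< N summand - - ((- 1ℚ) ^ suc n * ι (+ N)) ∎

theorem1p8 : (p r : ℕ) → Prime p → 2 ∤ p → 1 ≤ r →
    (∑[ k < p ℕ.^ r ] summand (toℕ k))
    ≡ - ((- 1ℚ) ^ (((p ℕ.∸ 1) ℕ.* r) ℕ./ 2) * (+ (p ℕ.^ r) / 1)) [mod p ^ (r ℕ.+ 2) ]
theorem1p8 p (suc r) p-prime 2∤p _ with odd 2∤p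
... | q , refl with odd-^ q (suc r)
-- N = 1 is excluded, as the terminating series must end before index N.
...   | zero  , p^[1+r]≡1 , _ = contradiction
  (subst (p ∣_) p^[1+r]≡1 (m∣m*n (p ℕ.^ r))) (Localisation.p∤1 p-prime)
...   | suc n , p^[1+r]≡ , sign≡ = ∈⇒valuation
  ((∑[ k < p ℕ.^ suc r ] summand (toℕ k)) - - ((- 1ℚ) ^ (((q ℕ.+ q) ℕ.* suc r) ℕ./ 2) * ι (+ (p ℕ.^ suc r))))
  (subst (_∈p^ (suc r ℕ.+ 2))
    (cong₂ (λ u v → u - - v)
      (trans (cong (λ N → Σ< N summand) (sym p^[1+r]≡)) (sym (∑≡Σ< (p ℕ.^ suc r) summand)))
      (cong₂ (λ u N → u * ι (+ N)) (trans sign≡ (cong ((- 1ℚ) ^_) (sym exponent))) (sym p^[1+r]≡)))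
    (OddPrimePower.Σsummand∈ p-prime p∤2 r n p^[1+r]≡))
  where
  open Localisation p-prime
  p∤2 : p ∤ 2
  p∤2 p∣2 with ℕ.≤∧≢⇒< (∣⇒≤ p∣2) (λ p≡2 → 2∤p (divides 1 p≡2))
  ... | p<2 = ℕ.<⇒≱ p<2 (ℕ.nonTrivial⇒n>1 p {{prime⇒nonTrivial p-prime}})
  -- After p has been replaced by 2q + 1, `p ∸ 1` reduces to `q + q`, and the division by 2 is
  -- exact.
  exponent : (q ℕ.+ q) ℕ.* suc r ℕ./ 2 ≡ q ℕ.* suc r
  exponent = trans (cong (ℕ._/ 2) (double q (suc r))) (m*n/n≡m (q ℕ.* suc r) 2)
    where
    double : ∀ q r → (q ℕ.+ q) ℕ.* r ≡ q ℕ.* r ℕ.* 2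
    double = ℕ-solve-∀
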